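{- The theory $\mathrm{ZF}^*-\mathrm{Ext}$ (that is, $\mathrm{ZF}^*$ with the axiom of Extensionality removed) interprets $\mathrm{ZF}$: there is a relative interpretation of $\mathrm{ZF}$ (standard Zermelo–Fraenkel set theory, with full Extensionality, Foundation and Replacement) in $\mathrm{ZF}^*-\mathrm{Ext}$, where the equality of $\mathrm{ZF}$ may be interpreted by a formula other than identity, the membership relation of $\mathrm{ZF}$ by a formula, and the quantifiers may be restricted to a definable domain.
   Context: The language is first-order logic with equality and one binary relation symbol $\in$. $\mathrm{ZF}^*$ is the theory with the axioms: - Extensionality: $\forall X\,\forall Y\,(\forall z(z\in X\leftrightarrow z\in Y)\rightarrow X=Y)$. - Foundation: $\forall A\,[\exists X(X\in A)\rightarrow \exists Y\in A\,(\neg\exists Z\in A\,(Z\in Y))]$. - Pairing: $\forall A\,\forall B\,\exists X\,\forall Y(Y\in X\leftrightarrow Y=A\lor Y=B)$. - Union: $\forall A\,\exists X\,\forall Y(Y\in X\leftrightarrow\exists Z\in A\,(Y\in Z))$. - Power: $\forall A\,\exists X\,\forall Y(Y\in X\leftrightarrow\forall Z\in Y\,(Z\in A))$. - Infinity: $\exists N\,(\emptyset\in N\wedge\forall n\in N\,\exists m\in N\,\forall y(y\in m\leftrightarrow y\in n\lor y=n))$, where $\emptyset\in N$ means that $N$ has an element that has no elements. - Replacement* (schema): for each formula $\phi(X,Z)$ in which only the symbols $X,Z$ occur free, and those occur only free, $\forall A\,\exists B\,\forall Y\,[Y\in B\leftrightarrow\exists X\in A\,\forall Z(Z\in Y\leftrightarrow\phi(X,Z))]$.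 $\mathrm{ZF}^*-\mathrm{Ext}$ is the theory with all of these axioms except Extensionality. -}

module Defs where

open import Data.Nat.Base using (ℕ; zero; suc; _+_)
open import Data.Fin.Base using (Fin; zero; suc; lift; _↑ʳ_)
open import Data.List.Base using (List; []; _∷_; map)
open import Data.List.Membership.Propositional using (_∈_)
open import Data.Product.Base using (Σ-syntax)
import Data.Vec.Functional as Vector
open Vector using (Vector)

------------------------------------------------------------------------
-- First-order logic with equality and one binary relation symbol

-- Formula n: formulas whose free variables are among n de Bruijn indices;
-- a quantifier binds index 0 of its body.  The language has no function
-- symbols, so variables are the only terms.

infix  9 _∈̇_ _≐_
infix  8 ¬̇_
infixr 7 _∧̇_
infixr 6 _∨̇_
infixr 5 _⇒_
infix  4 _⇔_
infix  3 ∀̇_ ∃̇_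

data Formula : ℕ → Set where
  _∈̇_ _≐_        : ∀ {n} → Fin n → Fin n → Formula n
  ⊥̇              : ∀ {n} → Formula n
  _⇒_ _∧̇_ _∨̇_   : ∀ {n} → Formula n → Formula n → Formula n
  ∀̇_ ∃̇_          : ∀ {n} → Formula (suc n) → Formula n

Sentence : Set
Sentence = Formula 0

¬̇_ : ∀ {n} → Formula n → Formula n
¬̇ φ = φ ⇒ ⊥̇

_⇔_ : ∀ {n} → Formula n → Formula n → Formula n
φ ⇔ ψ = (φ ⇒ ψ) ∧̇ (ψ ⇒ φ)

-- Simultaneous (capture-avoiding) substitution of variables for variables.
infixl 10 _⟪_⟫
_⟪_⟫ : ∀ {m n} → Formula m → Vector (Fin n) m → Formula n
(i ∈̇ j)  ⟪ ρ ⟫ = ρ i ∈̇ ρ j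
(i ≐ j)  ⟪ ρ ⟫ = ρ i ≐ ρ j
⊥̇        ⟪ ρ ⟫ = ⊥̇
(φ ⇒ ψ)  ⟪ ρ ⟫ = φ ⟪ ρ ⟫ ⇒ ψ ⟪ ρ ⟫
(φ ∧̇ ψ)  ⟪ ρ ⟫ = φ ⟪ ρ ⟫ ∧̇ ψ ⟪ ρ ⟫
(φ ∨̇ ψ)  ⟪ ρ ⟫ = φ ⟪ ρ ⟫ ∨̇ ψ ⟪ ρ ⟫
(∀̇ φ)    ⟪ ρ ⟫ = ∀̇ φ ⟪ lift 1 ρ ⟫
(∃̇ φ)    ⟪ ρ ⟫ = ∃̇ φ ⟪ lift 1 ρ ⟫

weaken : ∀ {n} → Formula n → Formula (suc n)
weaken φ = φ ⟪ suc ⟫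

embed : ∀ {n} → Sentence → Formula n
embed φ = φ ⟪ Vector.[] ⟫

_[_] : ∀ {n} → Formula (suc n) → Fin n → Formula n
φ [ i ] = φ ⟪ i Vector.∷ (λ j → j) ⟫

∀* : ∀ n → Formula n → Sentence
∀* zero    φ = φ
∀* (suc n) φ = ∀* n (∀̇ φ)

------------------------------------------------------------------------
-- Provability: classical natural deduction

Theory : Set₁
Theory = Sentence → Set

infix 2 _∣_⊢_
data _∣_⊢_ (T : Theory) : ∀ {n} → List (Formula n) → Formula n → Set where
  axiom   : ∀ {n} {Γ : List (Formula n)} {α} → T α → T ∣ Γ ⊢ embed α
  hyp     : ∀ {n} {Γ : List (Formula n)} {φ} → φ ∈ Γ → T ∣ Γ ⊢ φ
  raa     : ∀ {n} {Γ : List (Formula n)} {φ} → T ∣ (¬̇ φ) ∷ Γ ⊢ ⊥̇ → T ∣ Γ ⊢ φ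
  ⇒-intro : ∀ {n} {Γ : List (Formula n)} {φ ψ} → T ∣ φ ∷ Γ ⊢ ψ → T ∣ Γ ⊢ φ ⇒ ψ
  ⇒-elim  : ∀ {n} {Γ : List (Formula n)} {φ ψ} → T ∣ Γ ⊢ φ ⇒ ψ → T ∣ Γ ⊢ φ → T ∣ Γ ⊢ ψ
  ∧-intro : ∀ {n} {Γ : List (Formula n)} {φ ψ} → T ∣ Γ ⊢ φ → T ∣ Γ ⊢ ψ → T ∣ Γ ⊢ φ ∧̇ ψ
  ∧-elim₁ : ∀ {n} {Γ : List (Formula n)} {φ ψ} → T ∣ Γ ⊢ φ ∧̇ ψ → T ∣ Γ ⊢ φ
  ∧-elim₂ : ∀ {n} {Γ : List (Formula n)} {φ ψ} → T ∣ Γ ⊢ φ ∧̇ ψ → T ∣ Γ ⊢ ψ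
  ∨-intro₁ : ∀ {n} {Γ : List (Formula n)} {φ ψ} → T ∣ Γ ⊢ φ → T ∣ Γ ⊢ φ ∨̇ ψ
  ∨-intro₂ : ∀ {n} {Γ : List (Formula n)} {φ ψ} → T ∣ Γ ⊢ ψ → T ∣ Γ ⊢ φ ∨̇ ψ
  ∨-elim  : ∀ {n} {Γ : List (Formula n)} {φ ψ χ} →
            T ∣ Γ ⊢ φ ∨̇ ψ → T ∣ φ ∷ Γ ⊢ χ → T ∣ ψ ∷ Γ ⊢ χ → T ∣ Γ ⊢ χ
  ∀-intro : ∀ {n} {Γ : List (Formula n)} {φ} → T ∣ map weaken Γ ⊢ φ → T ∣ Γ ⊢ ∀̇ φ
  ∀-elim  : ∀ {n} {Γ : List (Formula n)} {φ} → T ∣ Γ ⊢ ∀̇ φ → ∀ i → T ∣ Γ ⊢ φ [ i ]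
  ∃-intro : ∀ {n} {Γ : List (Formula n)} {φ} i → T ∣ Γ ⊢ φ [ i ] → T ∣ Γ ⊢ ∃̇ φ
  ∃-elim  : ∀ {n} {Γ : List (Formula n)} {φ ψ} →
            T ∣ Γ ⊢ ∃̇ φ → T ∣ φ ∷ map weaken Γ ⊢ weaken ψ → T ∣ Γ ⊢ ψ
  ≐-refl  : ∀ {n} {Γ : List (Formula n)} i → T ∣ Γ ⊢ i ≐ i
  ≐-subst : ∀ {n} {Γ : List (Formula n)} (φ : Formula (suc n)) {i j} →
            T ∣ Γ ⊢ i ≐ j → T ∣ Γ ⊢ φ [ i ] → T ∣ Γ ⊢ φ [ j ]
  -- Domains are nonempty in standard first-order logic.  This does not follow
  -- from the other rules when n = 0, as there are then no terms.
  nonempty : ∀ {n} {Γ : List (Formula n)} → T ∣ Γ ⊢ ∃̇ zero ≐ zero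

infix 2 _⊢_
_⊢_ : Theory → Sentence → Set
T ⊢ φ = T ∣ [] ⊢ φ

------------------------------------------------------------------------
-- Relative interpretations

record Translation : Set where
  field
    domain     : Formula 1
    membership : Formula 2   -- index 0 ∈ index 1
    equality   : Formula 2   -- index 0 = index 1

  infix 10 _ᴵ
  _ᴵ : ∀ {n} → Formula n → Formula n
  (i ∈̇ j) ᴵ = membership ⟪ i Vector.∷ j Vector.∷ Vector.[] ⟫
  (i ≐ j) ᴵ = equality   ⟪ i Vector.∷ j Vector.∷ Vector.[] ⟫
  ⊥̇       ᴵ = ⊥̇
  (φ ⇒ ψ) ᴵ = φ ᴵ ⇒ ψ ᴵ
  (φ ∧̇ ψ) ᴵ = φ ᴵ ∧̇ ψ ᴵ
  (φ ∨̇ ψ) ᴵ = φ ᴵ ∨̇ ψ ᴵ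
  (∀̇ φ)   ᴵ = ∀̇ (domain ⟪ zero Vector.∷ Vector.[] ⟫ ⇒ φ ᴵ)
  (∃̇ φ)   ᴵ = ∃̇ (domain ⟪ zero Vector.∷ Vector.[] ⟫ ∧̇ φ ᴵ)

-- All theorems of T are translated, not only its axioms.  Since equality and
-- nonemptiness are part of the logic, this makes S prove that the domain is
-- nonempty and that the interpreted equality is a congruence on it.
infix 2 _interprets_
_interprets_ : Theory → Theory → Set
S interprets T =
  Σ[ I ∈ Translation ] (∀ (φ : Sentence) → T ⊢ φ → S ⊢ Translation._ᴵ I φ)

------------------------------------------------------------------------
-- The axioms

private
  v0 : ∀ {n} → Fin (1 + n)
  v0 = zero
  v1 : ∀ {n} → Fin (2 + n)
  v1 = suc v0
  v2 : ∀ {n} → Fin (3 + n)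
  v2 = suc v1
  v3 : ∀ {n} → Fin (4 + n)
  v3 = suc v2

-- ∀X ∀Y (∀z (z ∈ X ↔ z ∈ Y) → X = Y)
extensionality : Sentence
extensionality = ∀̇ ∀̇ ((∀̇ (v0 ∈̇ v2 ⇔ v0 ∈̇ v1)) ⇒ v1 ≐ v0)

-- ∀A [∃X (X ∈ A) → ∃Y ∈ A ¬ ∃Z ∈ A (Z ∈ Y)]
foundation : Sentence
foundation = ∀̇ ((∃̇ v0 ∈̇ v1) ⇒ (∃̇ (v0 ∈̇ v1 ∧̇ ¬̇ (∃̇ (v0 ∈̇ v2 ∧̇ v0 ∈̇ v1)))))

-- ∀A ∀B ∃X ∀Y (Y ∈ X ↔ Y = A ∨ Y = B)
pairing : Sentence
pairing = ∀̇ ∀̇ ∃̇ ∀̇ (v0 ∈̇ v1 ⇔ v0 ≐ v3 ∨̇ v0 ≐ v2)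

-- ∀A ∃X ∀Y (Y ∈ X ↔ ∃Z ∈ A (Y ∈ Z))
union : Sentence
union = ∀̇ ∃̇ ∀̇ (v0 ∈̇ v1 ⇔ (∃̇ (v0 ∈̇ v3 ∧̇ v1 ∈̇ v0)))

-- ∀A ∃X ∀Y (Y ∈ X ↔ ∀Z ∈ Y (Z ∈ A))
power : Sentence
power = ∀̇ ∃̇ ∀̇ (v0 ∈̇ v1 ⇔ (∀̇ (v0 ∈̇ v1 ⇒ v0 ∈̇ v3)))

-- ∃N (∃e ∈ N ¬ ∃y (y ∈ e) ∧ ∀n ∈ N ∃m ∈ N ∀y (y ∈ m ↔ y ∈ n ∨ y = n))
infinity : Sentence
infinity =
  ∃̇ ((∃̇ (v0 ∈̇ v1 ∧̇ ¬̇ (∃̇ v0 ∈̇ v1)))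
     ∧̇ (∀̇ (v0 ∈̇ v1 ⇒ (∃̇ (v0 ∈̇ v2 ∧̇ (∀̇ (v0 ∈̇ v1 ⇔ v0 ∈̇ v2 ∨̇ v0 ≐ v2)))))))

-- ∀A ∃B ∀Y [Y ∈ B ↔ ∃X ∈ A ∀Z (Z ∈ Y ↔ φ(X,Z))],
-- where X and Z are the variables 0 and 1 of φ, which has no parameters.
replacement* : Formula 2 → Sentence
replacement* φ =
  ∀̇ ∃̇ ∀̇ (v0 ∈̇ v1 ⇔
    (∃̇ (v0 ∈̇ v3 ∧̇ (∀̇ (v0 ∈̇ v2 ⇔ φ ⟪ v1 Vector.∷ v0 Vector.∷ Vector.[] ⟫)))))

-- ∀p⃗ ∀A [∀x ∈ A ∀y ∀z (φ(x,y,p⃗) ∧ φ(x,z,p⃗) → y = z)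
--         → ∃B ∀y (y ∈ B ↔ ∃x ∈ A φ(x,y,p⃗))],
-- where x and y are the variables 0 and 1 of φ and p⃗ are the others.  As φ need
-- only be a partial function on A, Separation for ψ is the case x = y ∧ ψ(x,p⃗).
replacement : ∀ n → Formula (2 + n) → Sentence
replacement n φ = ∀* n (∀̇
  ((∀̇ (v0 ∈̇ v1 ⇒ (∀̇ ∀̇ (φ ⟪ v2 Vector.∷ v1 Vector.∷ (4 ↑ʳ_) ⟫
                          ∧̇ φ ⟪ v2 Vector.∷ v0 Vector.∷ (4 ↑ʳ_) ⟫ ⇒ v1 ≐ v0))))
   ⇒ (∃̇ ∀̇ (v0 ∈̇ v1 ⇔ (∃̇ (v0 ∈̇ v3 ∧̇ φ ⟪ v0 Vector.∷ v1 Vector.∷ (4 ↑ʳ_) ⟫))))))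

data ZF*−Ext : Theory where
  foundation-ax   : ZF*−Ext foundation
  pairing-ax      : ZF*−Ext pairing
  union-ax        : ZF*−Ext union
  power-ax        : ZF*−Ext power
  infinity-ax     : ZF*−Ext infinity
  replacement*-ax : ∀ φ → ZF*−Ext (replacement* φ)

data ZF : Theory where
  extensionality-ax : ZF extensionality
  foundation-ax     : ZF foundation
  pairing-ax        : ZF pairing
  union-ax          : ZF union
  power-ax          : ZF power
  infinity-ax       : ZF infinity
  replacement-ax    : ∀ n φ → ZF (replacement n φ)

{-# OPTIONS --safe #-}
module Submission where

-- Constructive Gödel completeness turns the theorem into a model construction;
-- completeness holds constructively because structures come with their own
-- absurdity, an arbitrary proposition, and ∨ and ∃ are read negatively.
--
-- In a model of ZF* − Ext, call x ≋ y if x and y have the same elements, call a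
-- set closed if it contains every set ≋ to one of its elements, and hereditary
-- if it and all sets in its transitive closure are closed.  The hereditary sets
-- with ∈ as membership and ≋ as equality form a model of ZF.  Replacement*
-- and Union give the union of a family of classes {z : φ(x,z)}, x ∈ A,
-- whenever each of these classes is a set, and parameters are then absorbed by
-- applying this to A × {p}, which power set and tagged pairs provide.
-- An infinite hereditary set arises from the given one by replacing each n
-- with the class of the hereditary numerals that n counts.

open import Defs
open import Data.Empty using (⊥-elim)
open import Data.Fin.Base using (Fin; zero; suc; lift; _↑ʳ_)
open import Data.List.Base using (List; []; _∷_; _++_; map)
open import Data.List.Membership.Propositional.Properties using (∈-map⁻)
open import Data.List.Properties using (map-cong-local; map-∘)
open import Data.List.Relation.Binary.Subset.Propositional using (_⊆_)
open import Data.List.Relation.Binary.Subset.Propositional.Properties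
  using (map⁺; ∷⁺ʳ; xs⊆xs++ys; xs⊆ys++xs; ∈-∷⁺ʳ; xs⊆x∷xs)
open import Data.List.Relation.Unary.All as All using (All; []; _∷_)
open import Data.List.Relation.Unary.All.Properties using (++⁺)
open import Data.List.Relation.Unary.Any using (here; there)
open import Data.Nat.Base
  using (ℕ; zero; suc; _+_; _⊔_; _≤_; _<_; z≤n; s≤s; _≤′_; ≤′-refl; ≤′-step)
open import Data.Nat.Binary.Base using (ℕᵇ; 2[1+_]; 1+[2_]; toℕ) renaming (zero to 0ᵇ)
open import Data.Nat.Binary.Properties using (toℕ-injective)
open import Data.Nat.Properties as ℕ using (_≟_)
open import Data.Product.Base as Product using (Σ; Σ-syntax; _×_; _,_; proj₁; proj₂; swap)
open import Data.Sum.Base using (_⊎_; inj₁; inj₂)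
open import Data.Vec.Functional as Vector using (Vector)
open import Function.Base using (_∘_; id; const; case_of_)
open import Relation.Binary.PropositionalEquality
  using (_≡_; refl; sym; trans; cong; cong₂; subst₂)
open import Relation.Nullary using (yes; no)

private
  variable
    m n k : ℕ
    T : Theory
    Γ Δ : List (Formula n)
    φ ψ χ : Formula n

-- Substitution and structural rules

lift-cong : {ρ σ : Fin m → Fin n} → (∀ i → ρ i ≡ σ i) → ∀ i → lift 1 ρ i ≡ lift 1 σ i
lift-cong eq zero    = refl
lift-cong eq (suc i) = cong suc (eq i)

⟪⟫-cong : (φ : Formula m) {ρ σ : Fin m → Fin n} → (∀ i → ρ i ≡ σ i) → φ ⟪ ρ ⟫ ≡ φ ⟪ σ ⟫
⟪⟫-cong (i ∈̇ j) eq = cong₂ _∈̇_ (eq i) (eq j)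
⟪⟫-cong (i ≐ j) eq = cong₂ _≐_ (eq i) (eq j)
⟪⟫-cong ⊥̇       eq = refl
⟪⟫-cong (φ ⇒ ψ) eq = cong₂ _⇒_ (⟪⟫-cong φ eq) (⟪⟫-cong ψ eq)
⟪⟫-cong (φ ∧̇ ψ) eq = cong₂ _∧̇_ (⟪⟫-cong φ eq) (⟪⟫-cong ψ eq)
⟪⟫-cong (φ ∨̇ ψ) eq = cong₂ _∨̇_ (⟪⟫-cong φ eq) (⟪⟫-cong ψ eq)
⟪⟫-cong (∀̇ φ)   eq = cong ∀̇_ (⟪⟫-cong φ (lift-cong eq))
⟪⟫-cong (∃̇ φ)   eq = cong ∃̇_ (⟪⟫-cong φ (lift-cong eq))

lift-∘ : {ρ : Fin m → Fin n} {σ : Fin n → Fin k} {τ : Fin m → Fin k} →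
         (∀ i → σ (ρ i) ≡ τ i) → ∀ i → lift 1 σ (lift 1 ρ i) ≡ lift 1 τ i
lift-∘ eq zero    = refl
lift-∘ eq (suc i) = cong suc (eq i)

⟪⟫-∘ : (φ : Formula m) {ρ : Fin m → Fin n} {σ : Fin n → Fin k} {τ : Fin m → Fin k} →
       (∀ i → σ (ρ i) ≡ τ i) → φ ⟪ ρ ⟫ ⟪ σ ⟫ ≡ φ ⟪ τ ⟫
⟪⟫-∘ (i ∈̇ j) eq = cong₂ _∈̇_ (eq i) (eq j)
⟪⟫-∘ (i ≐ j) eq = cong₂ _≐_ (eq i) (eq j)
⟪⟫-∘ ⊥̇       eq = refl
⟪⟫-∘ (φ ⇒ ψ) eq = cong₂ _⇒_ (⟪⟫-∘ φ eq) (⟪⟫-∘ ψ eq)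
⟪⟫-∘ (φ ∧̇ ψ) eq = cong₂ _∧̇_ (⟪⟫-∘ φ eq) (⟪⟫-∘ ψ eq)
⟪⟫-∘ (φ ∨̇ ψ) eq = cong₂ _∨̇_ (⟪⟫-∘ φ eq) (⟪⟫-∘ ψ eq)
⟪⟫-∘ (∀̇ φ)   eq = cong ∀̇_ (⟪⟫-∘ φ (lift-∘ eq))
⟪⟫-∘ (∃̇ φ)   eq = cong ∃̇_ (⟪⟫-∘ φ (lift-∘ eq))

⊢-mono : Γ ⊆ Δ → T ∣ Γ ⊢ φ → T ∣ Δ ⊢ φ
⊢-mono s (axiom a)       = axiom a
⊢-mono s (hyp x)         = hyp (s x)
⊢-mono s (raa d)         = raa (⊢-mono (∷⁺ʳ _ s) d)
⊢-mono s (⇒-intro d)     = ⇒-intro (⊢-mono (∷⁺ʳ _ s) d)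
⊢-mono s (⇒-elim d d′)   = ⇒-elim (⊢-mono s d) (⊢-mono s d′)
⊢-mono s (∧-intro d d′)  = ∧-intro (⊢-mono s d) (⊢-mono s d′)
⊢-mono s (∧-elim₁ d)     = ∧-elim₁ (⊢-mono s d)
⊢-mono s (∧-elim₂ d)     = ∧-elim₂ (⊢-mono s d)
⊢-mono s (∨-intro₁ d)    = ∨-intro₁ (⊢-mono s d)
⊢-mono s (∨-intro₂ d)    = ∨-intro₂ (⊢-mono s d)
⊢-mono s (∨-elim d d₁ d₂) =
  ∨-elim (⊢-mono s d) (⊢-mono (∷⁺ʳ _ s) d₁) (⊢-mono (∷⁺ʳ _ s) d₂)
⊢-mono s (∀-intro d)     = ∀-intro (⊢-mono (map⁺ weaken s) d)
⊢-mono s (∀-elim d i)    = ∀-elim (⊢-mono s d) i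
⊢-mono s (∃-intro i d)   = ∃-intro i (⊢-mono s d)
⊢-mono s (∃-elim d d′)   = ∃-elim (⊢-mono s d) (⊢-mono (∷⁺ʳ _ (map⁺ weaken s)) d′)
⊢-mono s (≐-refl i)      = ≐-refl i
⊢-mono s (≐-subst φ d d′) = ≐-subst φ (⊢-mono s d) (⊢-mono s d′)
⊢-mono s nonempty        = nonempty

⊢-cast : φ ≡ ψ → T ∣ Γ ⊢ φ → T ∣ Γ ⊢ ψ
⊢-cast refl d = d

exfalso : T ∣ Γ ⊢ ⊥̇ → T ∣ Γ ⊢ φ
exfalso d = raa (⊢-mono (xs⊆x∷xs _ _) d)

⇒-elim-hyp : T ∣ Γ ⊢ ¬̇ φ → T ∣ φ ∷ Γ ⊢ ⊥̇
⇒-elim-hyp d = ⇒-elim (⊢-mono (xs⊆x∷xs _ _) d) (hyp (here refl))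

-- Classical semantics in which absurdity is an arbitrary proposition

-- In the term model `Absurd` is the inconsistency of a Henkin theory, which cannot be decided, so
-- it must not be fixed as the empty type. Stability of the two atoms is the only classical
-- assumption. Since `_≈_` is merely a congruence, no quotients are needed.
record Structure : Set₁ where
  infix 4 _ϵ_ _≈_
  field
    Carrier   : Set
    Absurd    : Set
    _ϵ_       : Carrier → Carrier → Set
    _≈_       : Carrier → Carrier → Set
    ∈-stable  : ∀ {x y} → ((x ϵ y → Absurd) → Absurd) → x ϵ y
    ≈-stable  : ∀ {x y} → ((x ≈ y → Absurd) → Absurd) → x ≈ y
    ≈-refl    : ∀ {x} → x ≈ x
    ≈-sym     : ∀ {x y} → x ≈ y → y ≈ x
    ≈-trans   : ∀ {x y z} → x ≈ y → y ≈ z → x ≈ z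
    ∈-resp    : ∀ {x x′ y y′} → x ≈ x′ → y ≈ y′ → x ϵ y → x′ ϵ y′
    inhabited : (Carrier → Absurd) → Absurd

module Semantics (𝔐 : Structure) where
  open Structure 𝔐 public

  Env : ℕ → Set
  Env n = Vector Carrier n

  infixr 1 _∨ˣ_
  _∨ˣ_ : Set → Set → Set
  A ∨ˣ B = (A → Absurd) → (B → Absurd) → Absurd

  infix 2 ∃ˣ
  ∃ˣ : (Carrier → Set) → Set
  ∃ˣ P = (∀ x → P x → Absurd) → Absurd
  syntax ∃ˣ (λ x → P) = ∃ˣ[ x ] P

  ⟦_⟧ : Formula n → Env n → Set
  ⟦ i ∈̇ j ⟧ e = e i ϵ e j
  ⟦ i ≐ j ⟧ e = e i ≈ e j
  ⟦ ⊥̇ ⟧     e = Absurd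
  ⟦ φ ⇒ ψ ⟧ e = ⟦ φ ⟧ e → ⟦ ψ ⟧ e
  ⟦ φ ∧̇ ψ ⟧ e = ⟦ φ ⟧ e × ⟦ ψ ⟧ e
  ⟦ φ ∨̇ ψ ⟧ e = ⟦ φ ⟧ e ∨ˣ ⟦ ψ ⟧ e
  ⟦ ∀̇ φ ⟧   e = ∀ x → ⟦ φ ⟧ (x Vector.∷ e)
  ⟦ ∃̇ φ ⟧   e = ∃ˣ[ x ] ⟦ φ ⟧ (x Vector.∷ e)

  Satisfies : Sentence → Set
  Satisfies φ = ⟦ φ ⟧ Vector.[]

  -- Negative disjunctions and existentials can be eliminated only into stable goals. Instance
  -- search supplies that stability to `∨-case` and `_>>=_`, so that arguments can be written as
  -- with ordinary case analysis and witnesses.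
  record Stable (A : Set) : Set where
    constructor stable
    field dne : ((A → Absurd) → Absurd) → A
  open Stable ⦃ ... ⦄ public

  instance
    Absurd-stable : Stable Absurd
    Absurd-stable = stable λ k → k id

    ∈-Stable : ∀ {x y} → Stable (x ϵ y)
    ∈-Stable = stable ∈-stable

    ≈-Stable : ∀ {x y} → Stable (x ≈ y)
    ≈-Stable = stable ≈-stable

    ×-Stable : ∀ {A B} → ⦃ Stable A ⦄ → ⦃ Stable B ⦄ → Stable (A × B)
    ×-Stable = stable λ k →
      dne (λ f → k (f ∘ proj₁)) , dne (λ f → k (f ∘ proj₂))

    Π-Stable : ∀ {A : Set} {B : A → Set} → ⦃ ∀ {x} → Stable (B x) ⦄ → Stable (∀ x → B x)
    Π-Stable = stable λ k x → dne λ f → k λ g → f (g x)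

  ⟦⟧-stable : (φ : Formula n) {e : Env n} → Stable (⟦ φ ⟧ e)
  ⟦⟧-stable (i ∈̇ j) = ∈-Stable
  ⟦⟧-stable (i ≐ j) = ≈-Stable
  ⟦⟧-stable ⊥̇       = Absurd-stable
  ⟦⟧-stable (φ ⇒ ψ) = Π-Stable ⦃ ⟦⟧-stable ψ ⦄
  ⟦⟧-stable (φ ∧̇ ψ) = ×-Stable ⦃ ⟦⟧-stable φ ⦄ ⦃ ⟦⟧-stable ψ ⦄
  ⟦⟧-stable (φ ∨̇ ψ) = Π-Stable
  ⟦⟧-stable (∀̇ φ)   = Π-Stable ⦃ ⟦⟧-stable φ ⦄
  ⟦⟧-stable (∃̇ φ)   = Π-Stable

  inlˣ : ∀ {A B} → A → A ∨ˣ B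
  inlˣ a k _ = k a

  inrˣ : ∀ {A B} → B → A ∨ˣ B
  inrˣ b _ k = k b

  ∨-case : ∀ {A B G} → ⦃ Stable G ⦄ → A ∨ˣ B → (A → G) → (B → G) → G
  ∨-case d f g = dne λ k → d (k ∘ f) (k ∘ g)

  someˣ : ∀ {P} x → P x → ∃ˣ P
  someˣ x p k = k x p

  infixl 1 _>>=_
  _>>=_ : ∀ {P G} → ⦃ Stable G ⦄ → ∃ˣ P → (∀ x → P x → G) → G
  d >>= f = dne λ k → d λ x p → k (f x p)

  absurd : ∀ {G} → ⦃ Stable G ⦄ → Absurd → G
  absurd r = dne λ _ → r

  -- Relating the environments by `_≈_` rather than propositional equality yields the substitution
  -- lemma and the congruence of equality at once. Both directions are proved together because
  -- implication is contravariant.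
  ⟦⟪⟫⟧ : (φ : Formula m) {ρ : Vector (Fin n) m} {e : Env n} {e′ : Env m} →
         (∀ i → e (ρ i) ≈ e′ i) →
         (⟦ φ ⟪ ρ ⟫ ⟧ e → ⟦ φ ⟧ e′) × (⟦ φ ⟧ e′ → ⟦ φ ⟪ ρ ⟫ ⟧ e)
  ⟦⟪⟫⟧ (i ∈̇ j) eq = ∈-resp (eq i) (eq j) , ∈-resp (≈-sym (eq i)) (≈-sym (eq j))
  ⟦⟪⟫⟧ (i ≐ j) eq =
    (λ p → ≈-trans (≈-sym (eq i)) (≈-trans p (eq j))) ,
    (λ p → ≈-trans (eq i) (≈-trans p (≈-sym (eq j))))
  ⟦⟪⟫⟧ ⊥̇       eq = id , id
  ⟦⟪⟫⟧ (φ ⇒ ψ) eq =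
    let f , f′ = ⟦⟪⟫⟧ φ eq ; g , g′ = ⟦⟪⟫⟧ ψ eq
    in (λ h → g ∘ h ∘ f′) , (λ h → g′ ∘ h ∘ f)
  ⟦⟪⟫⟧ (φ ∧̇ ψ) eq =
    let f , f′ = ⟦⟪⟫⟧ φ eq ; g , g′ = ⟦⟪⟫⟧ ψ eq
    in Product.map f g , Product.map f′ g′
  ⟦⟪⟫⟧ (φ ∨̇ ψ) eq =
    let f , f′ = ⟦⟪⟫⟧ φ eq ; g , g′ = ⟦⟪⟫⟧ ψ eq
    in (λ d k l → d (k ∘ f) (l ∘ g)) , (λ d k l → d (k ∘ f′) (l ∘ g′))
  ⟦⟪⟫⟧ (∀̇ φ)   eq =
    (λ h x → proj₁ (⟦⟪⟫⟧ φ λ { zero → ≈-refl ; (suc i) → eq i }) (h x)) ,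
    (λ h x → proj₂ (⟦⟪⟫⟧ φ λ { zero → ≈-refl ; (suc i) → eq i }) (h x))
  ⟦⟪⟫⟧ (∃̇ φ)   eq =
    (λ h k → h λ x → k x ∘ proj₁ (⟦⟪⟫⟧ φ λ { zero → ≈-refl ; (suc i) → eq i })) ,
    (λ h k → h λ x → k x ∘ proj₂ (⟦⟪⟫⟧ φ λ { zero → ≈-refl ; (suc i) → eq i }))

  ⟦⟧-resp : (φ : Formula n) {e e′ : Env n} → (∀ i → e i ≈ e′ i) → ⟦ φ ⟧ e → ⟦ φ ⟧ e′
  ⟦⟧-resp φ eq = proj₁ (⟦⟪⟫⟧ φ {ρ = id} eq) ∘ proj₂ (⟦⟪⟫⟧ φ {ρ = id} λ _ → ≈-refl)

  Hyps : List (Formula n) → Env n → Set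
  Hyps Γ e = All (λ ψ → ⟦ ψ ⟧ e) Γ

  Hyps-weaken : ∀ {e : Env n} {x} → Hyps Γ e → Hyps (map weaken Γ) (x Vector.∷ e)
  Hyps-weaken []       = []
  Hyps-weaken (_∷_ {φ} p ps) = proj₂ (⟦⟪⟫⟧ φ λ _ → ≈-refl) p ∷ Hyps-weaken ps

  sound : (∀ α → T α → Satisfies α) → T ∣ Γ ⊢ φ → ∀ e → Hyps Γ e → ⟦ φ ⟧ e
  sound M (axiom {α = α} a)  e h = proj₂ (⟦⟪⟫⟧ α λ ()) (M α a)
  sound M (hyp x)            e h = All.lookup h x
  sound M (raa {φ = φ} d)    e h = Stable.dne (⟦⟧-stable φ) λ k → sound M d e (k ∷ h)
  sound M (⇒-intro d)        e h = λ p → sound M d e (p ∷ h)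
  sound M (⇒-elim d d′)      e h = sound M d e h (sound M d′ e h)
  sound M (∧-intro d d′)     e h = sound M d e h , sound M d′ e h
  sound M (∧-elim₁ d)        e h = proj₁ (sound M d e h)
  sound M (∧-elim₂ d)        e h = proj₂ (sound M d e h)
  sound M (∨-intro₁ d)       e h = inlˣ (sound M d e h)
  sound M (∨-intro₂ d)       e h = inrˣ (sound M d e h)
  sound M (∨-elim {χ = χ} d d₁ d₂) e h =
    ∨-case ⦃ ⟦⟧-stable χ ⦄ (sound M d e h)
      (λ p → sound M d₁ e (p ∷ h)) (λ p → sound M d₂ e (p ∷ h))
  sound M (∀-intro d)        e h = λ x → sound M d (x Vector.∷ e) (Hyps-weaken h)
  sound M (∀-elim {φ = φ} d i) e h =
    proj₂ (⟦⟪⟫⟧ φ λ { zero → ≈-refl ; (suc _) → ≈-refl }) (sound M d e h (e i))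
  sound M (∃-intro {φ = φ} i d) e h =
    someˣ (e i) (proj₁ (⟦⟪⟫⟧ φ λ { zero → ≈-refl ; (suc _) → ≈-refl }) (sound M d e h))
  sound M (∃-elim {ψ = ψ} d d′) e h =
    _>>=_ ⦃ ⟦⟧-stable ψ ⦄ (sound M d e h) λ x p →
      proj₁ (⟦⟪⟫⟧ ψ λ _ → ≈-refl) (sound M d′ (x Vector.∷ e) (p ∷ Hyps-weaken h))
  sound M (≐-refl i)         e h = ≈-refl
  sound M (≐-subst φ {i} {j} d d′) e h =
    let ij = sound M d e h in
    proj₂ (⟦⟪⟫⟧ φ {e′ = e i Vector.∷ e} λ { zero → ≈-sym ij ; (suc _) → ≈-refl })
      (proj₁ (⟦⟪⟫⟧ φ λ { zero → ≈-refl ; (suc _) → ≈-refl }) (sound M d′ e h))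
  sound M nonempty           e h = λ k → inhabited λ x → k x ≈-refl

Models : Structure → Theory → Set
Models 𝔐 T = ∀ α → T α → Semantics.Satisfies 𝔐 α

-- Gödel numbering

-- Formulas over infinitely many de Bruijn indices.  The atoms with tags 0, 1
-- and 2 are ∈, = and ⊥; the nodes with tags 0, …, 4 are ⇒, ∧, ∨, ∀ and ∃, where
-- a quantifier ignores its second argument.
data Tree : Set where
  atom : ℕ → ℕ → ℕ → Tree
  node : ℕ → Tree → Tree → Tree

infixr 5 _∷ᴺ_
_∷ᴺ_ : {A : Set} → A → (ℕ → A) → ℕ → A
(x ∷ᴺ ρ) zero    = x
(x ∷ᴺ ρ) (suc k) = ρ k

liftᴺ : (ℕ → Fin n) → ℕ → Fin (suc n)
liftᴺ ρ = zero ∷ᴺ (suc ∘ ρ)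

inst : Tree → (ℕ → Fin n) → Formula n
inst (atom 0 i j) ρ = ρ i ∈̇ ρ j
inst (atom 1 i j) ρ = ρ i ≐ ρ j
inst (atom _ i j) ρ = ⊥̇
inst (node 0 s t) ρ = inst s ρ ⇒ inst t ρ
inst (node 1 s t) ρ = inst s ρ ∧̇ inst t ρ
inst (node 2 s t) ρ = inst s ρ ∨̇ inst t ρ
inst (node 3 s t) ρ = ∀̇ inst s (liftᴺ ρ)
inst (node _ s t) ρ = ∃̇ inst s (liftᴺ ρ)

tree : Formula n → Vector ℕ n → Tree
tree (i ∈̇ j) e = atom 0 (e i) (e j)
tree (i ≐ j) e = atom 1 (e i) (e j)
tree ⊥̇       e = atom 2 0 0
tree (φ ⇒ ψ) e = node 0 (tree φ e) (tree ψ e)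
tree (φ ∧̇ ψ) e = node 1 (tree φ e) (tree ψ e)
tree (φ ∨̇ ψ) e = node 2 (tree φ e) (tree ψ e)
tree (∀̇ φ)   e = node 3 (tree φ (0 Vector.∷ suc ∘ e)) (atom 2 0 0)
tree (∃̇ φ)   e = node 4 (tree φ (0 Vector.∷ suc ∘ e)) (atom 2 0 0)

private
  lift-tree : {e : Vector ℕ m} {ρ : ℕ → Fin n} {σ : Fin m → Fin n} → (∀ i → ρ (e i) ≡ σ i) →
              ∀ i → liftᴺ ρ ((0 Vector.∷ suc ∘ e) i) ≡ lift 1 σ i
  lift-tree eq zero    = refl
  lift-tree eq (suc i) = cong suc (eq i)

inst-tree : (φ : Formula m) {e : Vector ℕ m} {ρ : ℕ → Fin n} {σ : Fin m → Fin n} →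
            (∀ i → ρ (e i) ≡ σ i) → inst (tree φ e) ρ ≡ φ ⟪ σ ⟫
inst-tree (i ∈̇ j) eq = cong₂ _∈̇_ (eq i) (eq j)
inst-tree (i ≐ j) eq = cong₂ _≐_ (eq i) (eq j)
inst-tree ⊥̇       eq = refl
inst-tree (φ ⇒ ψ) eq = cong₂ _⇒_ (inst-tree φ eq) (inst-tree ψ eq)
inst-tree (φ ∧̇ ψ) eq = cong₂ _∧̇_ (inst-tree φ eq) (inst-tree ψ eq)
inst-tree (φ ∨̇ ψ) eq = cong₂ _∨̇_ (inst-tree φ eq) (inst-tree ψ eq)
inst-tree (∀̇ φ) {e} {ρ} eq = cong ∀̇_ (inst-tree φ (lift-tree {e = e} {ρ} eq))
inst-tree (∃̇ φ) {e} {ρ} eq = cong ∃̇_ (inst-tree φ (lift-tree {e = e} {ρ} eq))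

-- Binary numbers serve as strings over the two digits `2[1+_]` and `1+[2_]`: a block of the first
-- closed by one of the second is self-delimiting. `encode` is thus a prefix code, and the code
-- exceeds every number written in it.
unary : ℕ → ℕᵇ → ℕᵇ
unary zero    s = 1+[2 s ]
unary (suc k) s = 2[1+ unary k s ]

unary-injective : ∀ k l {s t} → unary k s ≡ unary l t → k ≡ l × s ≡ t
unary-injective zero    zero    refl = refl , refl
unary-injective (suc k) (suc l) eq   =
  Product.map₁ (cong suc) (unary-injective k l (cong (λ { 2[1+ s ] → s ; s → s }) eq))

encode : Tree → ℕᵇ → ℕᵇ
encode (atom o i j) s = 2[1+ unary o (unary i (unary j s)) ]
encode (node o t u) s = 1+[2 unary o (encode t (encode u s)) ]

encode-injective : ∀ t u {r s} → encode t r ≡ encode u s → t ≡ u × r ≡ s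
encode-injective (atom o i j) (atom o′ i′ j′) eq
  with unary-injective o o′ (cong (λ { 2[1+ s ] → s ; s → s }) eq)
... | refl , eq₁ with unary-injective i i′ eq₁
... | refl , eq₂ with unary-injective j j′ eq₂
... | refl , eq₃ = refl , eq₃
encode-injective (node o t u) (node o′ t′ u′) eq
  with unary-injective o o′ (cong (λ { 1+[2 s ] → s ; s → s }) eq)
... | refl , eq₁ with encode-injective t t′ eq₁
... | refl , eq₂ with encode-injective u u′ eq₂
... | refl , eq₃ = refl , eq₃

code : Tree → ℕ
code t = toℕ (encode t 0ᵇ)

code-injective : ∀ {t u} → code t ≡ code u → t ≡ u
code-injective {t} {u} eq = proj₁ (encode-injective t u (toℕ-injective eq))

private
  ≤-2[1+] : ∀ s → suc (toℕ s) ≤ toℕ 2[1+ s ]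
  ≤-2[1+] s = ℕ.m≤m+n (suc (toℕ s)) _

  ≤-1+[2] : ∀ s → suc (toℕ s) ≤ toℕ 1+[2 s ]
  ≤-1+[2] s = s≤s (ℕ.m≤m+n (toℕ s) _)

unary-bound : ∀ k s → k + toℕ s < toℕ (unary k s)
unary-bound zero    s = ≤-1+[2] s
unary-bound (suc k) s = ℕ.≤-trans (s≤s (unary-bound k s)) (≤-2[1+] (unary k s))

encode-bound : ∀ t s → toℕ s ≤ toℕ (encode t s)
encode-bound (atom o i j) s = begin
  toℕ s                               ≤⟨ drop j s ⟩
  toℕ (unary j s)                     ≤⟨ drop i _ ⟩
  toℕ (unary i (unary j s))           ≤⟨ drop o _ ⟩
  toℕ (unary o (unary i (unary j s))) <⟨ ≤-2[1+] (unary o _) ⟩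
  toℕ (encode (atom o i j) s)         ∎
  where
  open ℕ.≤-Reasoning
  drop : ∀ k s → toℕ s ≤ toℕ (unary k s)
  drop k s = ℕ.≤-trans (ℕ.m≤n+m (toℕ s) k) (ℕ.<⇒≤ (unary-bound k s))
encode-bound (node o t u) s = begin
  toℕ s                                 ≤⟨ encode-bound u s ⟩
  toℕ (encode u s)                      ≤⟨ encode-bound t _ ⟩
  toℕ (encode t (encode u s))           ≤⟨ ℕ.m≤n+m _ o ⟩
  o + toℕ (encode t (encode u s))       <⟨ unary-bound o _ ⟩
  toℕ (unary o (encode t (encode u s))) <⟨ ≤-1+[2] (unary o _) ⟩
  toℕ (encode (node o t u) s)           ∎
  where open ℕ.≤-Reasoning

private
  lift-agree : ∀ {b} {ρ : ℕ → Fin m} {ρ′ : ℕ → Fin n} {σ : Fin m → Fin n} →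
               (∀ k → k < b → ρ′ k ≡ σ (ρ k)) → ∀ k → k < b → liftᴺ ρ′ k ≡ lift 1 σ (liftᴺ ρ k)
  lift-agree h zero    _  = refl
  lift-agree h (suc k) lt = cong suc (h k (ℕ.<-trans (ℕ.n<1+n k) lt))

  -- The tail `s` is general because `encode` threads it through subtrees. The bound `b` survives
  -- quantifiers unchanged, since under `liftᴺ` the index `suc k` only consults `k`.
  inst-natural′ : ∀ {b} (ρ : ℕ → Fin m) (ρ′ : ℕ → Fin n) (σ : Fin m → Fin n) t s →
                  toℕ (encode t s) ≤ b → (∀ k → k < b → ρ′ k ≡ σ (ρ k)) →
                  inst t ρ′ ≡ inst t ρ ⟪ σ ⟫
  inst-natural′ {b = b} ρ ρ′ σ (atom o i j) s le h = go o i<b j<b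
    where
    open ℕ.≤-Reasoning
    tail≤ : toℕ (unary i (unary j s)) < b
    tail≤ = begin-strict
      toℕ (unary i (unary j s))           ≤⟨ ℕ.m≤n+m _ o ⟩
      o + toℕ (unary i (unary j s))       <⟨ unary-bound o _ ⟩
      toℕ (unary o (unary i (unary j s))) <⟨ ≤-2[1+] (unary o _) ⟩
      toℕ (encode (atom o i j) s)         ≤⟨ le ⟩
      b                                   ∎
    i<b : i < b
    i<b = begin-strict
      i                         ≤⟨ ℕ.m≤m+n i _ ⟩
      i + toℕ (unary j s)       <⟨ unary-bound i _ ⟩
      toℕ (unary i (unary j s)) <⟨ tail≤ ⟩
      b                         ∎
    j<b : j < b
    j<b = begin-strict
      j                         ≤⟨ ℕ.m≤m+n j _ ⟩
      j + toℕ s                 <⟨ unary-bound j _ ⟩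
      toℕ (unary j s)           ≤⟨ ℕ.m≤n+m _ i ⟩
      i + toℕ (unary j s)       <⟨ unary-bound i _ ⟩
      toℕ (unary i (unary j s)) <⟨ tail≤ ⟩
      b                         ∎
    go : ∀ o → i < b → j < b → inst (atom o i j) ρ′ ≡ inst (atom o i j) ρ ⟪ σ ⟫
    go 0             i< j< = cong₂ _∈̇_ (h i i<) (h j j<)
    go 1             i< j< = cong₂ _≐_ (h i i<) (h j j<)
    go (suc (suc _)) i< j< = refl
  inst-natural′ {b = b} ρ ρ′ σ (node o t u) s le h = go o
    where
    open ℕ.≤-Reasoning
    t≤ : toℕ (encode t (encode u s)) ≤ b
    t≤ = begin
      toℕ (encode t (encode u s))           ≤⟨ ℕ.m≤n+m _ o ⟩
      o + toℕ (encode t (encode u s))       <⟨ unary-bound o _ ⟩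
      toℕ (unary o (encode t (encode u s))) <⟨ ≤-1+[2] (unary o _) ⟩
      toℕ (encode (node o t u) s)           ≤⟨ le ⟩
      b                                     ∎
    u≤ : toℕ (encode u s) ≤ b
    u≤ = ℕ.≤-trans (encode-bound t _) t≤
    t= : inst t ρ′ ≡ inst t ρ ⟪ σ ⟫
    t= = inst-natural′ ρ ρ′ σ t _ t≤ h
    u= : inst u ρ′ ≡ inst u ρ ⟪ σ ⟫
    u= = inst-natural′ ρ ρ′ σ u _ u≤ h
    t↑ : inst t (liftᴺ ρ′) ≡ inst t (liftᴺ ρ) ⟪ lift 1 σ ⟫
    t↑ = inst-natural′ (liftᴺ ρ) (liftᴺ ρ′) (lift 1 σ) t _ t≤ (lift-agree {ρ = ρ} {ρ′} {σ} h)
    go : ∀ o → inst (node o t u) ρ′ ≡ inst (node o t u) ρ ⟪ σ ⟫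
    go 0 = cong₂ _⇒_ t= u=
    go 1 = cong₂ _∧̇_ t= u=
    go 2 = cong₂ _∨̇_ t= u=
    go 3 = cong ∀̇_ t↑
    go (suc (suc (suc (suc _)))) = cong ∃̇_ t↑

-- The variables of a formula are smaller than its code.
inst-natural : ∀ t (ρ : ℕ → Fin m) (ρ′ : ℕ → Fin n) (σ : Fin m → Fin n) →
               (∀ k → k < code t → ρ′ k ≡ σ (ρ k)) → inst t ρ′ ≡ inst t ρ ⟪ σ ⟫
inst-natural t ρ ρ′ σ = inst-natural′ ρ ρ′ σ t 0ᵇ ℕ.≤-refl

-- Henkin completeness

-- The drinker paradox: some x satisfies χ(x) → ∀χ. If the implication fails for a generic x, then χ
-- holds generically, hence ∀χ, and `nonempty` supplies an x for which the implication holds after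
-- all.
drinker : (χ : Formula (suc n)) → T ∣ (χ ⇒ weaken (∀̇ χ)) ∷ map weaken Γ ⊢ ⊥̇ → T ∣ Γ ⊢ ⊥̇
drinker {T = T} {Γ} χ d = ⇒-elim (⇒-intro refuted) all-χ
  where
  all-χ : T ∣ Γ ⊢ ∀̇ χ
  all-χ = ∀-intro (raa (⇒-elim (⊢-mono (xs⊆x∷xs _ _) (⇒-intro d))
    (⇒-intro (exfalso (⇒-elim (hyp (there (here refl))) (hyp (here refl)))))))
  refuted : T ∣ (∀̇ χ) ∷ Γ ⊢ ⊥̇
  refuted = ∃-elim nonempty
    (⇒-elim (⊢-mono (λ p → there (there p)) (⇒-intro d)) (⇒-intro (hyp (there (there (here refl))))))

-- A family stands for a formula with parameters from ℕ.
record Family : Set where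
  constructor family
  field at : ∀ {n} → (ℕ → Fin n) → Formula n
open Family

closure : Formula n → Vector ℕ n → Family
closure φ e = family λ ρ → φ ⟪ ρ ∘ e ⟫

⊥ᶠ : Family
⊥ᶠ = family λ _ → ⊥̇

¬ᶠ_ : Family → Family
at (¬ᶠ f) ρ = ¬̇ at f ρ

⟨_⟩ : Tree → Family
at ⟨ t ⟩ ρ = inst t ρ

-- The witness is the parameter `code t`, which is new because the variables of `t` lie below it.
-- The universal form matches `drinker`.
henkin : Tree → Family
at (henkin t) ρ = inst t (ρ (code t) ∷ᴺ ρ) ⇒ (∀̇ inst t (liftᴺ ρ))

-- A family carries no syntax in which parameters could be inspected, so having all parameters below
-- `b` is expressed as naturality under renamings that agree below `b`.
Bounded : ℕ → Family → Set
Bounded b f = ∀ {m n} (ρ : ℕ → Fin m) (ρ′ : ℕ → Fin n) (σ : Fin m → Fin n) →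
              (∀ k → k < b → ρ′ k ≡ σ (ρ k)) → at f ρ′ ≡ at f ρ ⟪ σ ⟫

Bounded-mono : ∀ {b c f} → b ≤ c → Bounded b f → Bounded c f
Bounded-mono le bd ρ ρ′ σ h = bd ρ ρ′ σ λ k lt → h k (ℕ.<-≤-trans lt le)

⟨⟩-bounded : ∀ t → Bounded (code t) ⟨ t ⟩
⟨⟩-bounded t = inst-natural t

henkin-bounded : ∀ t → Bounded (suc (code t)) (henkin t)
henkin-bounded t ρ ρ′ σ h = cong₂ (λ α β → α ⇒ (∀̇ β))
  (inst-natural t (ρ (code t) ∷ᴺ ρ) (ρ′ (code t) ∷ᴺ ρ′) σ
    λ { zero _ → h _ ℕ.≤-refl ; (suc k) lt → h k (ℕ.≤-trans (ℕ.<⇒≤ lt) (ℕ.n≤1+n _)) })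
  (inst-natural t (liftᴺ ρ) (liftᴺ ρ′) (lift 1 σ)
    λ { zero _ → refl ; (suc k) lt → cong suc (h k (ℕ.≤-trans (ℕ.<⇒≤ lt) (ℕ.n≤1+n _))) })

-- ρ moved up by one, with the freed variable 0 assigned to the parameter c.
fresh : ℕ → (ℕ → Fin n) → ℕ → Fin (suc n)
fresh c ρ k with k ≟ c
... | yes _ = zero
... | no  _ = suc (ρ k)

fresh-at : ∀ c (ρ : ℕ → Fin n) → fresh c ρ c ≡ zero
fresh-at c ρ with c ≟ c
... | yes _ = refl
... | no  c≢c = ⊥-elim (c≢c refl)

fresh-below : ∀ c (ρ : ℕ → Fin n) k → k < c → fresh c ρ k ≡ suc (ρ k)
fresh-below c ρ k k<c with k ≟ c
... | yes refl = ⊥-elim (ℕ.<-irrefl refl k<c)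
... | no  _ = refl

module Henkin (S : Theory) (φ₀ : Sentence) where

  infix 3 _⊩_ _⊫_
  -- Derivability with constants from ℕ, expressed without enlarging the language: the constants may
  -- be assigned to variables in any way.
  _⊩_ : List Family → Family → Set
  Γ ⊩ f = ∀ {n} (ρ : ℕ → Fin n) → S ∣ map (λ g → at g ρ) Γ ⊢ at f ρ

  _⊫_ : (Family → Set) → Family → Set
  Δ ⊫ f = Σ[ Γ ∈ List Family ] All Δ Γ × Γ ⊩ f

  ⊩-mono : ∀ {Γ Δ f} → Γ ⊆ Δ → Γ ⊩ f → Δ ⊩ f
  ⊩-mono s d ρ = ⊢-mono (map⁺ _ s) (d ρ)

  ⊫-mono : ∀ {Δ Δ′ : Family → Set} {f} → (∀ {g} → Δ g → Δ′ g) → Δ ⊫ f → Δ′ ⊫ f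
  ⊫-mono s (Γ , all , d) = Γ , All.map s all , d

  ⊫-hyp : ∀ {Δ f} → Δ f → Δ ⊫ f
  ⊫-hyp {f = f} x = f ∷ [] , x ∷ [] , λ ρ → hyp (here refl)

  ⊫-theorem : ∀ {Δ f} → (∀ {n} (ρ : ℕ → Fin n) → S ∣ [] ⊢ at f ρ) → Δ ⊫ f
  ⊫-theorem d = [] , [] , λ ρ → d ρ

  ⊫-map : ∀ {Δ f g} → (∀ {n} (ρ : ℕ → Fin n) {Γ} → S ∣ Γ ⊢ at f ρ → S ∣ Γ ⊢ at g ρ) →
          Δ ⊫ f → Δ ⊫ g
  ⊫-map r (Γ , all , d) = Γ , all , λ ρ → r ρ (d ρ)

  ⊫-map₂ : ∀ {Δ f g h} →
           (∀ {n} (ρ : ℕ → Fin n) {Γ} → S ∣ Γ ⊢ at f ρ → S ∣ Γ ⊢ at g ρ → S ∣ Γ ⊢ at h ρ) →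
           Δ ⊫ f → Δ ⊫ g → Δ ⊫ h
  ⊫-map₂ {f = f} {g} {h} r (Γ , all , d) (Γ′ , all′ , d′) = Γ ++ Γ′ , ++⁺ all all′ ,
    λ ρ → r ρ (⊩-mono {f = f} (xs⊆xs++ys Γ Γ′) d ρ) (⊩-mono {f = g} (xs⊆ys++xs Γ′ Γ) d′ ρ)

  ⊫-cast : ∀ {Δ f g} → (∀ {n} (ρ : ℕ → Fin n) → at f ρ ≡ at g ρ) → Δ ⊫ f → Δ ⊫ g
  ⊫-cast {f = f} {g} eq = ⊫-map {f = f} {g} λ ρ → ⊢-cast (eq ρ)

  -- Extension of Δ by at most one further family F t.
  Extend : (Family → Set) → (Tree → Set) → (Tree → Family) → Family → Set
  Extend Δ Q F f = Δ f ⊎ Σ[ t ∈ Tree ] Q t × f ≡ F t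

  -- The tags of `Extend` tell old entries from new ones, and uniqueness of the tree merges all new
  -- entries into a single `F t`, ready to be discharged.
  split : ∀ {Δ Q F} → (∀ {t u} → Q t → Q u → t ≡ u) → ∀ {Γ} → All (Extend Δ Q F) Γ →
          Σ[ Γ′ ∈ List Family ] All Δ Γ′ × (Γ ⊆ Γ′ ⊎ Σ[ t ∈ Tree ] Q t × Γ ⊆ F t ∷ Γ′)
  split u [] = [] , [] , inj₁ id
  split u (x ∷ xs) with split u xs
  split u (inj₁ d ∷ xs) | Γ′ , all , inj₁ s = _ ∷ Γ′ , d ∷ all , inj₁ (∷⁺ʳ _ s)
  split u (inj₁ d ∷ xs) | Γ′ , all , inj₂ (t , q , s) = _ ∷ Γ′ , d ∷ all , inj₂ (t , q ,
    λ { (here refl) → there (here refl) ; (there p) → case s p of λ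
      { (here e) → here e ; (there p′) → there (there p′) } })
  split u (inj₂ (t , q , refl) ∷ xs) | Γ′ , all , inj₁ s = Γ′ , all , inj₂ (t , q , ∷⁺ʳ _ s)
  split u (inj₂ (t , q , refl) ∷ xs) | Γ′ , all , inj₂ (t′ , q′ , s) with u q q′
  ... | refl = Γ′ , all , inj₂ (t′ , q′ , ∈-∷⁺ʳ (here refl) s)

  -- Stage b + 1 treats the formula with code b: it adds a Henkin axiom with
  -- the parameter b for it, and then the formula itself if that is consistent.
  Stage  : ℕ → Family → Set
  Half   : ℕ → Family → Set
  Chosen : ℕ → Tree → Set
  Stage zero    f = f ≡ closure (¬̇ φ₀) Vector.[]
  Stage (suc b)   = Extend (Half b) (Chosen b) ⟨_⟩
  Half b          = Extend (Stage b) (λ t → code t ≡ b) henkin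
  Chosen b t      = code t ≡ b × (Half b ⊫ ¬ᶠ ⟨ t ⟩ → Half b ⊫ ⊥ᶠ)

  stage-bounded : ∀ b {f} → Stage b f → Bounded b f
  stage-bounded zero refl ρ ρ′ σ h = sym (⟪⟫-∘ (¬̇ φ₀) λ ())
  stage-bounded (suc b) (inj₁ (inj₁ x)) = Bounded-mono (ℕ.n≤1+n b) (stage-bounded b x)
  stage-bounded (suc b) (inj₁ (inj₂ (t , refl , refl))) = henkin-bounded t
  stage-bounded (suc b) (inj₂ (t , (refl , _) , refl)) =
    Bounded-mono (ℕ.n≤1+n (code t)) (⟨⟩-bounded t)

  -- Evaluate the derivation at an assignment sending the parameter `code t` to a new variable. The
  -- entries of `Γ`, bounded by it, become weakenings, and the Henkin axiom becomes the hypothesis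
  -- of `drinker`.
  henkin-conservative : ∀ t {Γ} → All (Bounded (code t)) Γ → henkin t ∷ Γ ⊩ ⊥ᶠ → Γ ⊩ ⊥ᶠ
  henkin-conservative t {Γ} bd d ρ = drinker body (subst₂ (λ α Δ → S ∣ α ∷ Δ ⊢ ⊥̇) head-eq tail-eq (d ρ⁺))
    where
    c  = code t
    ρ⁺ = fresh c ρ
    body  = inst t (zero ∷ᴺ ρ⁺)
    below : ∀ k → k < c → ρ⁺ k ≡ suc (ρ k)
    below = fresh-below c ρ
    head-eq : at (henkin t) ρ⁺ ≡ (body ⇒ weaken (∀̇ body))
    head-eq = cong₂ (λ α β → α ⇒ (∀̇ β)) (cong (λ i → inst t (i ∷ᴺ ρ⁺)) (fresh-at c ρ))
      (inst-natural t (zero ∷ᴺ ρ⁺) (liftᴺ ρ⁺) (lift 1 suc) λ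
        { zero    _  → refl
        ; (suc k) lt → let eq = below k (ℕ.<⇒≤ lt)
                       in trans (cong suc eq) (sym (cong (lift 1 suc) eq)) })
    tail-eq : map (λ g → at g ρ⁺) Γ ≡ map weaken (map (λ g → at g ρ) Γ)
    tail-eq = trans (map-cong-local (All.map (λ b → b ρ ρ⁺ suc below) bd)) (map-∘ Γ)

  half-consistent : ∀ b → Half b ⊫ ⊥ᶠ → Stage b ⊫ ⊥ᶠ
  half-consistent b (Γ , all , d)
    with split (λ p q → code-injective (trans p (sym q))) all
  ... | Γ′ , all′ , inj₁ s = Γ′ , all′ , ⊩-mono {f = ⊥ᶠ} s d
  ... | Γ′ , all′ , inj₂ (t , refl , s) = Γ′ , all′ ,
    henkin-conservative t (All.map (λ {f} → stage-bounded b {f}) all′) (⊩-mono {f = ⊥ᶠ} s d)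

  -- No consistency is ever decided. If a derivation of absurdity uses the chosen formula, it gives
  -- a refutation of that formula, and the condition in `Chosen` turns this into an inconsistency of
  -- `Half b`.
  stage-consistent : ∀ b → Stage b ⊫ ⊥ᶠ → Stage 0 ⊫ ⊥ᶠ
  stage-consistent zero d = d
  stage-consistent (suc b) (Γ , all , d)
    with split (λ p q → code-injective (trans (proj₁ p) (sym (proj₁ q)))) all
  ... | Γ′ , all′ , inj₁ s =
    stage-consistent b (half-consistent b (Γ′ , all′ , ⊩-mono {f = ⊥ᶠ} s d))
  ... | Γ′ , all′ , inj₂ (t , (_ , consistent) , s) =
    stage-consistent b (half-consistent b (consistent
      (Γ′ , all′ , λ ρ → ⇒-intro (⊩-mono {f = ⊥ᶠ} s d ρ))))

  -- The limit of the Henkin stages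

  Ω : Family → Set
  Ω f = Σ[ b ∈ ℕ ] Stage b f

  stage-mono : ∀ {b c f} → b ≤ c → Stage b f → Stage c f
  stage-mono {b} {f = f} le = go (ℕ.≤⇒≤′ le)
    where
    go : ∀ {c} → b ≤′ c → Stage b f → Stage c f
    go ≤′-refl     x = x
    go (≤′-step l) x = inj₁ (inj₁ (go l x))

  Ω-finite : ∀ {Γ} → All Ω Γ → Σ[ b ∈ ℕ ] All (Stage b) Γ
  Ω-finite [] = 0 , []
  Ω-finite ((b , x) ∷ xs) =
    let c , ys = Ω-finite xs
    in b ⊔ c , stage-mono (ℕ.m≤m⊔n b c) x ∷ All.map (stage-mono (ℕ.m≤n⊔m b c)) ys

  Ω-consistent : Ω ⊫ ⊥ᶠ → Stage 0 ⊫ ⊥ᶠ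
  Ω-consistent (Γ , all , d) = let b , all′ = Ω-finite all in stage-consistent b (Γ , all′ , d)

  Ω-maximal : (φ : Formula n) (e : Vector ℕ n) →
              (Ω ⊫ ¬ᶠ closure φ e → Ω ⊫ ⊥ᶠ) → Ω ⊫ closure φ e
  Ω-maximal φ e h = ⊫-cast {f = ⟨ t ⟩} {closure φ e} (λ ρ → inst-tree φ λ _ → refl)
    (⊫-hyp (suc (code t) , inj₂ (t , (refl , consistent) , refl)))
    where
    t = tree φ e
    consistent : Half (code t) ⊫ ¬ᶠ ⟨ t ⟩ → Half (code t) ⊫ ⊥ᶠ
    -- A refutation from this half is one from `Ω`. The resulting inconsistency falls to stage 0 and
    -- is then lifted back into the half.
    consistent d = ⊫-mono {f = ⊥ᶠ} (λ x → inj₁ (stage-mono {c = code t} z≤n x))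
      (Ω-consistent (h (⊫-cast {f = ¬ᶠ ⟨ t ⟩} {¬ᶠ closure φ e}
        (λ ρ → cong ¬̇_ (inst-tree φ λ _ → refl))
        (⊫-mono {f = ¬ᶠ ⟨ t ⟩} (λ x → suc (code t) , inj₁ x) d))))

  Ω-stable : (φ : Formula n) (e : Vector ℕ n) →
             ((Ω ⊫ closure φ e → Ω ⊫ ⊥ᶠ) → Ω ⊫ ⊥ᶠ) → Ω ⊫ closure φ e
  Ω-stable φ e h = Ω-maximal φ e λ neg →
    h λ pos → ⊫-map₂ {f = ¬ᶠ closure φ e} {closure φ e} {⊥ᶠ} (λ ρ → ⇒-elim) neg pos

  Ω-⇒ : (φ ψ : Formula n) (e : Vector ℕ n) →
        (Ω ⊫ closure φ e → Ω ⊫ closure ψ e) → Ω ⊫ closure (φ ⇒ ψ) e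
  Ω-⇒ φ ψ e h = Ω-maximal (φ ⇒ ψ) e λ neg →
    ⊫-map₂ {f = ¬ᶠ closure (φ ⇒ ψ) e} {closure ψ e} {⊥ᶠ}
      (λ ρ d d′ → ⇒-elim d (⇒-intro (⊢-mono (xs⊆x∷xs _ _) d′))) neg
      (h (⊫-map {f = ¬ᶠ closure (φ ⇒ ψ) e} {closure φ e}
        (λ ρ d → raa (⇒-elim (⊢-mono (xs⊆x∷xs _ _) d)
          (⇒-intro (exfalso (⇒-elim (hyp (there (here refl))) (hyp (here refl))))))) neg))

  -- The Henkin axiom reduces the claim to one instance, at its own parameter `code t`.
  Ω-∀ : (φ : Formula (suc n)) (e : Vector ℕ n) →
        (∀ c → Ω ⊫ closure φ (c Vector.∷ e)) → Ω ⊫ closure (∀̇ φ) e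
  Ω-∀ φ e h = ⊫-map₂ {f = henkin t} {closure φ (c Vector.∷ e)} {closure (∀̇ φ) e}
    (λ ρ d d′ → ⊢-cast (cong ∀̇_ (inst-tree φ (all-eq ρ)))
      (⇒-elim d (⊢-cast (sym (inst-tree φ (inst-eq ρ))) d′)))
    (⊫-hyp (suc c , inj₁ (inj₂ (t , refl , refl)))) (h c)
    where
    t = tree φ (0 Vector.∷ suc ∘ e)
    c = code t
    inst-eq : (ρ : ℕ → Fin k) → ∀ i → (ρ c ∷ᴺ ρ) ((0 Vector.∷ suc ∘ e) i) ≡ ρ ((c Vector.∷ e) i)
    inst-eq ρ zero    = refl
    inst-eq ρ (suc i) = refl
    all-eq : (ρ : ℕ → Fin k) → ∀ i → liftᴺ ρ ((0 Vector.∷ suc ∘ e) i) ≡ lift 1 (ρ ∘ e) i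
    all-eq ρ zero    = refl
    all-eq ρ (suc i) = refl

  instance-eq : (φ : Formula (suc n)) (e : Vector ℕ n) (c : ℕ) (ρ : ℕ → Fin k) →
                (φ ⟪ lift 1 (ρ ∘ e) ⟫) [ ρ c ] ≡ φ ⟪ ρ ∘ (c Vector.∷ e) ⟫
  instance-eq φ e c ρ = ⟪⟫-∘ φ λ { zero → refl ; (suc i) → refl }

  -- The term model and the truth lemma

  private
    x≐y x∈y : Formula 2
    x≐y = zero ≐ suc zero
    x∈y = zero ∈̇ suc zero

    pair : ℕ → ℕ → Vector ℕ 2
    pair a b = a Vector.∷ b Vector.∷ Vector.[]

  term-model : Structure
  term-model = record
    { Carrier    = ℕ
    ; Absurd     = Ω ⊫ ⊥ᶠ
    ; _ϵ_       = λ a b → Ω ⊫ closure x∈y (pair a b)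
    ; _≈_        = λ a b → Ω ⊫ closure x≐y (pair a b)
    ; ∈-stable   = λ {a} {b} → Ω-stable x∈y (pair a b)
    ; ≈-stable   = λ {a} {b} → Ω-stable x≐y (pair a b)
    ; ≈-refl     = λ {a} → ⊫-theorem {f = closure x≐y (pair a a)} λ ρ → ≐-refl (ρ a)
    ; ≈-sym      = λ {a} {b} → ⊫-map {f = closure x≐y (pair a b)} {closure x≐y (pair b a)} λ ρ → ⊢-sym
    ; ≈-trans    = λ {a} {b} {c} →
        ⊫-map₂ {f = closure x≐y (pair a b)} {closure x≐y (pair b c)} {closure x≐y (pair a c)}
          λ ρ d d′ → ≐-subst (suc _ ≐ zero) d′ d
    ; ∈-resp     = λ {a} {a′} {b} {b′} p q r →
        ⊫-map₂ {f = closure x≐y (pair b b′)} {closure x∈y (pair a′ b)} {closure x∈y (pair a′ b′)}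
          (λ ρ → ≐-subst (suc _ ∈̇ zero)) q
          (⊫-map₂ {f = closure x≐y (pair a a′)} {closure x∈y (pair a b)} {closure x∈y (pair a′ b)}
            (λ ρ → ≐-subst (zero ∈̇ suc _)) p r)
    ; inhabited  = λ k → k 0
    }
    where
    ⊢-sym : ∀ {n} {Γ : List (Formula n)} {i j} → S ∣ Γ ⊢ i ≐ j → S ∣ Γ ⊢ j ≐ i
    ⊢-sym {i = i} d = ≐-subst (zero ≐ suc i) d (≐-refl i)

  open Semantics term-model using (⟦_⟧; Satisfies)

  -- The truth lemma, with its directions mutual because implication swaps them. As disjunction and
  -- existence are read negatively, `truth` needs `Ω-stable` there, and `untruth` must refute the
  -- formula given refutations of its parts.
  truth   : (φ : Formula n) (e : Vector ℕ n) → ⟦ φ ⟧ e → Ω ⊫ closure φ e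
  untruth : (φ : Formula n) (e : Vector ℕ n) → Ω ⊫ closure φ e → ⟦ φ ⟧ e

  truth (i ∈̇ j) e p = p
  truth (i ≐ j) e p = p
  truth ⊥̇       e p = p
  truth (φ ⇒ ψ) e p = Ω-⇒ φ ψ e λ d → truth ψ e (p (untruth φ e d))
  truth (φ ∧̇ ψ) e (p , q) =
    ⊫-map₂ {f = closure φ e} {closure ψ e} {closure (φ ∧̇ ψ) e} (λ ρ → ∧-intro) (truth φ e p) (truth ψ e q)
  truth (φ ∨̇ ψ) e p = Ω-stable (φ ∨̇ ψ) e λ k → p
    (λ x → k (⊫-map {f = closure φ e} {closure (φ ∨̇ ψ) e} (λ ρ → ∨-intro₁) (truth φ e x)))
    (λ y → k (⊫-map {f = closure ψ e} {closure (φ ∨̇ ψ) e} (λ ρ → ∨-intro₂) (truth ψ e y)))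
  truth (∀̇ φ)   e p = Ω-∀ φ e λ c → truth φ (c Vector.∷ e) (p c)
  truth (∃̇ φ)   e p = Ω-stable (∃̇ φ) e λ k → p λ c x →
    k (⊫-map {f = closure φ (c Vector.∷ e)} {closure (∃̇ φ) e}
      (λ ρ d → ∃-intro (ρ c) (⊢-cast (sym (instance-eq φ e c ρ)) d))
      (truth φ (c Vector.∷ e) x))

  untruth (i ∈̇ j) e d = d
  untruth (i ≐ j) e d = d
  untruth ⊥̇       e d = d
  untruth (φ ⇒ ψ) e d = λ p → untruth ψ e
    (⊫-map₂ {f = closure (φ ⇒ ψ) e} {closure φ e} {closure ψ e} (λ ρ → ⇒-elim) d (truth φ e p))
  untruth (φ ∧̇ ψ) e d =
    untruth φ e (⊫-map {f = closure (φ ∧̇ ψ) e} {closure φ e} (λ ρ → ∧-elim₁) d) ,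
    untruth ψ e (⊫-map {f = closure (φ ∧̇ ψ) e} {closure ψ e} (λ ρ → ∧-elim₂) d)
  untruth (φ ∨̇ ψ) e d k l =
    ⊫-map₂ {f = closure (φ ∨̇ ψ) e} {closure (¬̇ φ ∧̇ ¬̇ ψ) e} {⊥ᶠ}
      (λ ρ d d′ → ∨-elim d (⇒-elim-hyp (∧-elim₁ d′)) (⇒-elim-hyp (∧-elim₂ d′))) d
      (⊫-map₂ {f = closure (¬̇ φ) e} {closure (¬̇ ψ) e} {closure (¬̇ φ ∧̇ ¬̇ ψ) e} (λ ρ → ∧-intro)
        (Ω-⇒ φ ⊥̇ e (k ∘ untruth φ e)) (Ω-⇒ ψ ⊥̇ e (l ∘ untruth ψ e)))
  untruth (∀̇ φ)   e d = λ c → untruth φ (c Vector.∷ e)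
    (⊫-map {f = closure (∀̇ φ) e} {closure φ (c Vector.∷ e)}
      (λ ρ d → ⊢-cast (instance-eq φ e c ρ) (∀-elim d (ρ c))) d)
  untruth (∃̇ φ)   e d k =
    ⊫-map₂ {f = closure (∃̇ φ) e} {closure (∀̇ ¬̇ φ) e} {⊥ᶠ} (λ ρ d d′ → ⇒-elim (⇒-intro (none ρ d)) d′) d
      (Ω-∀ (¬̇ φ) e λ c → Ω-⇒ φ ⊥̇ (c Vector.∷ e) (k c ∘ untruth φ (c Vector.∷ e)))
    where
    none : ∀ {n} (ρ : ℕ → Fin n) {Γ} →
           S ∣ Γ ⊢ (∃̇ φ) ⟪ ρ ∘ e ⟫ → S ∣ (∀̇ ¬̇ φ) ⟪ ρ ∘ e ⟫ ∷ Γ ⊢ ⊥̇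
    none ρ d = ∃-elim (⊢-mono (xs⊆x∷xs _ _) d)
      (⇒-elim (⊢-cast eq (∀-elim (hyp (there (here refl))) zero)) (hyp (here refl)))
      where
      neg = ¬̇ φ ⟪ lift 1 (ρ ∘ e) ⟫
      eq : (neg ⟪ lift 1 suc ⟫) [ zero ] ≡ neg
      eq = trans (⟪⟫-∘ neg λ _ → refl) (⟪⟫-∘ (¬̇ φ) λ { zero → refl ; (suc i) → refl })

  term-model-models : Models term-model S
  term-model-models α ax = untruth α Vector.[] (⊫-theorem {f = closure α Vector.[]}
    λ ρ → ⊢-cast (⟪⟫-cong α λ ()) (axiom ax))

  refuted : Stage 0 ⊫ ⊥ᶠ → S ⊢ φ₀
  -- There is no assignment of parameters in the empty context, so `nonempty` provides one variable
  -- and all parameters are sent to it.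
  refuted (Γ , all , d) = ∃-elim nonempty (raa (⊢-mono sub (d (const zero))))
    where
    sub : map (λ g → at g (const zero)) Γ ⊆ ¬̇ weaken φ₀ ∷ (zero ≐ zero) ∷ []
    sub p with ∈-map⁻ _ p
    ... | g , g∈Γ , refl with All.lookup all g∈Γ
    ... | refl = here (cong ¬̇_ (⟪⟫-cong φ₀ λ ()))

  -- Truth of `φ₀` contradicts its negation, put in at stage 0, and `Ω-consistent` converts the
  -- contradiction into a derivation. The term model need not be known to be consistent.
  term-model-complete : Satisfies φ₀ → S ⊢ φ₀
  term-model-complete p = refuted (Ω-consistent
    (⊫-map₂ {f = closure (¬̇ φ₀) Vector.[]} {closure φ₀ Vector.[]} {⊥ᶠ} (λ ρ → ⇒-elim)
      (⊫-hyp (0 , refl)) (truth φ₀ Vector.[] p)))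

completeness : ∀ S φ → (∀ 𝔐 → Models 𝔐 S → Semantics.Satisfies 𝔐 φ) → S ⊢ φ
completeness S φ valid = term-model-complete (valid term-model term-model-models)
  where open Henkin S φ

-- Coextensionality and pairs

infix 9 _≋̇_
_≋̇_ : Fin n → Fin n → Formula n
x ≋̇ y = ∀̇ (zero ∈̇ suc x ⇔ zero ∈̇ suc y)

empty : Fin n → Formula n
empty x = ∀̇ ¬̇ (zero ∈̇ suc x)

singleton : Fin n → Fin n → Formula n
singleton s x = ∀̇ (zero ∈̇ suc s ⇔ zero ≋̇ suc x)

tag : Fin n → Fin n → Formula n
tag v p = ∀̇ (zero ∈̇ suc v ⇔ singleton zero (suc p) ∨̇ empty zero)

pair : Fin n → Fin n → Fin n → Formula n
pair t x p = ∀̇ (zero ∈̇ suc t ⇔ singleton zero (suc x) ∨̇ tag zero (suc p))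

module Sets (𝔐 : Structure) where
  open Semantics 𝔐 public

  infix 0 _↔_
  _↔_ : Set → Set → Set
  A ↔ B = (A → B) × (B → A)

  infix 3 _represents_
  _represents_ : Carrier → (Carrier → Set) → Set
  c represents P = ∀ z → z ϵ c ↔ P z

  Small : (Carrier → Set) → Set
  Small P = ∃ˣ[ c ] c represents P

  infix 4 _≋_
  _≋_ : Carrier → Carrier → Set
  x ≋ y = x represents (_ϵ y)

  Empty : Carrier → Set
  Empty x = ∀ z → z ϵ x → Absurd

  represents-map : ∀ {c} {P Q : Carrier → Set} → (∀ z → P z ↔ Q z) → c represents P → c represents Q
  represents-map f r z = proj₁ (f z) ∘ proj₁ (r z) , proj₂ (r z) ∘ proj₂ (f z)

  Small-map : {P Q : Carrier → Set} → (∀ z → P z ↔ Q z) → Small P → Small Q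
  Small-map f s k = s λ c r → k c (represents-map f r)

  ≋-refl : ∀ {x} → x ≋ x
  ≋-refl z = id , id

  ≋-sym : ∀ {x y} → x ≋ y → y ≋ x
  ≋-sym p z = swap (p z)

  ≋-trans : ∀ {x y z} → x ≋ y → y ≋ z → x ≋ z
  ≋-trans p q = represents-map q p

  ≈⇒≋ : ∀ {x y} → x ≈ y → x ≋ y
  ≈⇒≋ p z = ∈-resp ≈-refl p , ∈-resp ≈-refl (≈-sym p)

  represents-resp : ∀ {c d P} → c ≋ d → c represents P → d represents P
  represents-resp p r = represents-map r (≋-sym p)

  represents-unique : ∀ {c d P} → c represents P → d represents P → c ≋ d
  represents-unique p q = represents-map (λ z → swap (q z)) p

  Empty-represents : ∀ {x} → Empty x → x represents λ _ → Absurd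
  Empty-represents e z = e z , absurd

  Empty-resp : ∀ {x y} → x ≋ y → Empty x → Empty y
  Empty-resp p e z = e z ∘ proj₂ (p z)

  ≋-represents : ∀ {s z P} → s represents P → (z ≋ s) ↔ (z represents P)
  ≋-represents r = (λ p → represents-resp (≋-sym p) r) , (λ r′ → represents-unique r′ r)

  ∨-map : ∀ {A B C D} → (A → C) → (B → D) → A ∨ˣ B → C ∨ˣ D
  ∨-map f g h k l = h (k ∘ f) (l ∘ g)

  ∨-cong : ∀ {A B C D} → A ↔ C → B ↔ D → A ∨ˣ B ↔ C ∨ˣ D
  ∨-cong f g = ∨-map (proj₁ f) (proj₁ g) , ∨-map (proj₂ f) (proj₂ g)

  ≋-congʳ : ∀ {x y} → x ≋ y → ∀ z → (z ≋ x) ↔ (z ≋ y)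
  ≋-congʳ p z = (λ q → ≋-trans q p) , (λ q → ≋-trans q (≋-sym p))

  Singleton : Carrier → Carrier → Set
  Singleton s x = s represents (_≋ x)

  Tag : Carrier → Carrier → Set
  Tag v p = v represents λ z → Singleton z p ∨ˣ Empty z

  -- The Wiener pair {{x}, {{p}, ∅}} up to coextensionality.
  Pair : Carrier → Carrier → Carrier → Set
  Pair t x p = t represents λ z → Singleton z x ∨ˣ Tag z p

  Singleton-cong : ∀ {x y} → x ≋ y → ∀ s → Singleton s x ↔ Singleton s y
  Singleton-cong p s = represents-map (≋-congʳ p) , represents-map (≋-congʳ (≋-sym p))

  Tag-cong : ∀ {p q} → p ≋ q → ∀ v → Tag v p ↔ Tag v q
  Tag-cong p v =
    represents-map (λ z → ∨-cong (Singleton-cong p z) (id , id)) ,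
    represents-map (λ z → ∨-cong (Singleton-cong (≋-sym p) z) (id , id))

  Pair-resp : ∀ {t t′ x x′ p p′} → t ≋ t′ → x ≋ x′ → p ≋ p′ → Pair t x p → Pair t′ x′ p′
  Pair-resp e f g r =
    represents-resp e (represents-map (λ z → ∨-cong (Singleton-cong f z) (Tag-cong g z)) r)

  -- The pair contains all copies of `a` and `b`, where copies are coextensional sets. In this form
  -- it makes sense both in the ambient model and in the inner one.
  record Pairing : Set where
    field
      unordered-pair : ∀ a b → Small λ y → (y ≋ a) ∨ˣ (y ≋ b)
      empty-set      : ∃ˣ Empty

  module PairingProperties (𝔓 : Pairing) where
    open Pairing 𝔓 public

    class-pair : ∀ {a b P Q} → a represents P → b represents Q →
                 Small λ y → (y represents P) ∨ˣ (y represents Q)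
    class-pair r s = Small-map (λ z → ∨-cong (≋-represents r) (≋-represents s)) (unordered-pair _ _)

    singleton-exists : ∀ a → ∃ˣ[ s ] Singleton s a
    singleton-exists a = Small-map (λ z → (λ d → ∨-case d id id) , inlˣ) (unordered-pair a a)

    tag-exists : ∀ p → ∃ˣ[ v ] Tag v p
    tag-exists p = singleton-exists p >>= λ s r → empty-set >>= λ e empty →
      Small-map (λ z → ∨-cong (id , id) ((λ r′ y → proj₁ (r′ y)) , Empty-represents))
        (class-pair r (Empty-represents empty))

    pair-exists : ∀ x p → ∃ˣ[ t ] Pair t x p
    pair-exists x p = singleton-exists x >>= λ s r → tag-exists p >>= λ v r′ → class-pair r r′

    Singleton-injective : ∀ {s x y} → Singleton s x → Singleton s y → x ≋ y
    Singleton-injective {x = x} r r′ = proj₁ (r′ x) (proj₂ (r x) ≋-refl)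

    -- The elements of a singleton are coextensional to each other, whereas a tag contains both the
    -- empty set and a nonempty one. This lets the two components of a pair be told apart.
    Singleton-not-Tag : ∀ {s x p} → Singleton s x → Tag s p → Absurd
    Singleton-not-Tag {p = p} r r′ = singleton-exists p >>= λ u q → empty-set >>= λ e empty →
      let e≋x = proj₁ (r e) (proj₂ (r′ e) (inrˣ empty))
          u≋x = proj₁ (r u) (proj₂ (r′ u) (inlˣ q))
      in empty p (proj₂ (≋-trans e≋x (≋-sym u≋x) p) (proj₂ (q p) ≋-refl))

    Tag-injective : ∀ {v p q} → Tag v p → Tag v q → p ≋ q
    Tag-injective {v} {p} r r′ = singleton-exists p >>= λ s t →
      ∨-case (proj₁ (r′ s) (proj₂ (r s) (inlˣ t))) (Singleton-injective t)
        λ empty → absurd (empty p (proj₂ (t p) ≋-refl))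

    Pair-injective₁ : ∀ {t x x′ p p′} → Pair t x p → Pair t x′ p′ → x ≋ x′
    Pair-injective₁ {x = x} r r′ = singleton-exists x >>= λ s q →
      ∨-case (proj₁ (r′ s) (proj₂ (r s) (inlˣ q))) (Singleton-injective q)
        λ q′ → absurd (Singleton-not-Tag q q′)

    Pair-injective₂ : ∀ {t x x′ p p′} → Pair t x p → Pair t x′ p′ → p ≋ p′
    Pair-injective₂ {p = p} r r′ = tag-exists p >>= λ v q →
      ∨-case (proj₁ (r′ v) (proj₂ (r v) (inrˣ q)))
        (λ q′ → absurd (Singleton-not-Tag q′ q)) (Tag-injective q)

    -- Whether `P` is inhabited is not decided. Suppose that `P` is not small. Any element of `P`
    -- would make a singleton represent it, so `P` is empty and the empty set represents it.
    subsingleton-small : (P : Carrier → Set) → ⦃ ∀ {y} → Stable (P y) ⦄ →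
                         (∀ {y z} → P y → P z → y ≋ z) → (∀ {y z} → y ≋ z → P y → P z) → Small P
    subsingleton-small P unique resp k = empty-set λ e empty →
      k e λ z → (λ p → absurd (empty z p)) , λ p → absurd (singleton-exists z λ c r →
        k c λ y → (λ q → resp (≋-sym (proj₁ (r y) q)) p) , (λ q → proj₂ (r y) (unique q p)))

-- Replacement with parameters

module _ (𝔐 : Structure) where
  open Sets 𝔐

  record UnionPairing : Set where
    field
      pairs  : Pairing
      unions : ∀ a → Small λ y → ∃ˣ[ z ] (z ϵ a × y ϵ z)

  module UnionPairingProperties (𝔘 : UnionPairing) where
    open UnionPairing 𝔘 public
    open PairingProperties pairs public

    binary-union : ∀ {P Q} → Small P → Small Q → Small λ y → P y ∨ˣ Q y
    binary-union {P} {Q} p q = p >>= λ a r → q >>= λ b s → unordered-pair a b >>= λ c t →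
      Small-map (λ y →
        (λ h → h >>= λ z (z∈c , y∈z) → ∨-map
          (λ z≋a → proj₁ (r y) (proj₁ (z≋a y) y∈z))
          (λ z≋b → proj₁ (s y) (proj₁ (z≋b y) y∈z)) (proj₁ (t z) z∈c)) ,
        (λ h → ∨-case h
          (λ py → someˣ a (proj₂ (t a) (inlˣ ≋-refl) , proj₂ (r y) py))
          (λ qy → someˣ b (proj₂ (t b) (inrˣ ≋-refl) , proj₂ (s y) qy))))
        (unions c)

    class-small : ∀ {a P} → a represents P → Small λ y → y represents P
    class-small r = Small-map (λ _ → ≋-represents r) (singleton-exists _)

  -- In `collect` the formula has no parameters: `e` is an environment of length 0, left variable
  -- because such functions are not definitionally equal.
  record Extensional : Set where
    field
      extensional   : ∀ {x y} → x ≋ y → x ≈ y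
      union-pairing : UnionPairing
      powers        : ∀ a → Small λ y → ∀ z → z ϵ y → z ϵ a
      collect       : ∀ (φ : Formula 2) e a →
                      (∀ x → x ϵ a → Small λ y → ⟦ φ ⟧ (x Vector.∷ y Vector.∷ e)) →
                      Small λ y → ∃ˣ[ x ] (x ϵ a × ⟦ φ ⟧ (x Vector.∷ y Vector.∷ e))

  module ExtensionalProperties (𝔈 : Extensional) where
    open Extensional 𝔈 public
    open UnionPairingProperties union-pairing public

    -- Filtering may not mention `a` or `p`, since `collect` admits no parameters. So both go into
    -- the set `u` of singletons of elements of `a` and tags of `p`: any pair included in `u` has
    -- its first component in `a` and its second coextensional to `p`. It remains to filter the
    -- power set of `u` by being some pair.
    product : ∀ a p → Small λ t → ∃ˣ[ x ] (x ϵ a × Pair t x p)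
    product a p =
      binary-union singletons (tag-exists p >>= λ v → class-small) >>= λ u members →
      powers u >>= λ w subsets →
      Small-map (λ t →
        (λ h → h >>= λ t′ (t′∈w , t′≈t , h′) → h′ >>= λ x h″ → h″ >>= λ q r →
          inside members (proj₁ (subsets t′) t′∈w) r >>= λ _ (x∈a , r′) →
          someˣ x (x∈a , Pair-resp (≈⇒≋ t′≈t) ≋-refl ≋-refl r′)) ,
        (λ h → h >>= λ x (x∈a , r) → someˣ t
          ( proj₂ (subsets t) (λ z z∈t → proj₂ (members z)
              (∨-map (λ s → someˣ x (x∈a , s)) id (proj₁ (r z) z∈t)))
          , ≈-refl , someˣ x (someˣ p r))))
        (collect pair-filter Vector.[] w λ t _ → subsingleton-small _
          (λ (t≈y , _) (t≈z , _) → ≈⇒≋ (≈-trans (≈-sym t≈y) t≈z))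
          (λ y≋z (t≈y , h) → ≈-trans t≈y (extensional y≋z) , h))
      where
      pair-filter : Formula 2
      pair-filter = zero ≐ suc zero ∧̇ (∃̇ ∃̇ pair (suc (suc zero)) (suc zero) zero)

      singletons : Small λ u → ∃ˣ[ x ] (x ϵ a × Singleton u x)
      singletons = collect (singleton (suc zero) zero) Vector.[] a λ x _ →
        singleton-exists x >>= λ s → class-small

      inside : ∀ {u t x q} →
               (∀ z → z ϵ u ↔ ((∃ˣ[ x ] (x ϵ a × Singleton z x)) ∨ˣ Tag z p)) →
               (∀ z → z ϵ t → z ϵ u) → Pair t x q → ∃ˣ[ _ ] (x ϵ a × Pair t x p)
      inside {x = x} {q} members t⊆u r = singleton-exists x >>= λ s sx → tag-exists q >>= λ v vq →
        let x∈a = ∨-case (proj₁ (members s) (t⊆u s (proj₂ (r s) (inlˣ sx))))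
                    (λ h → h >>= λ y (y∈a , sy) →
                      ∈-resp (extensional (Singleton-injective sy sx)) ≈-refl y∈a)
                    (λ sp → absurd (Singleton-not-Tag sx sp))
            q≋p = ∨-case (proj₁ (members v) (t⊆u v (proj₂ (r v) (inrˣ vq))))
                    (λ h → h >>= λ y (_ , vy) → absurd (Singleton-not-Tag vy vq))
                    (Tag-injective vq)
        in someˣ x (x∈a , Pair-resp ≋-refl ≋-refl q≋p r)

    -- The parameters are absorbed one at a time into the elements of a × {p}.
    collect* : ∀ n (φ : Formula (2 + n)) e a →
               (∀ x → x ϵ a → Small λ y → ⟦ φ ⟧ (x Vector.∷ y Vector.∷ e)) →
               Small λ y → ∃ˣ[ x ] (x ϵ a × ⟦ φ ⟧ (x Vector.∷ y Vector.∷ e))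
    collect* zero    φ e a small = collect φ e a small
    collect* (suc n) φ e a small = product a p >>= λ c members →
      Small-map (λ y →
        (λ h → h >>= λ t (t∈c , h₁) → proj₁ (members t) t∈c >>= λ x (x∈a , r) →
          someˣ x (x∈a , proj₁ (unfold r) h₁)) ,
        (λ h → h >>= λ x (x∈a , h₁) → pair-exists x p >>= λ t r →
          someˣ t (proj₂ (members t) (someˣ x (x∈a , r)) , proj₂ (unfold r) h₁)))
        (collect* n φ′ e′ c λ t t∈c → proj₁ (members t) t∈c >>= λ x (x∈a , r) →
          Small-map (λ y → swap (unfold r)) (small x x∈a))
      where
      p  = e zero
      e′ = Vector.tail e

      ρ : Vector (Fin (4 + n)) (3 + n)
      ρ = suc zero Vector.∷ suc (suc (suc zero)) Vector.∷ zero Vector.∷ (4 ↑ʳ_)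

      φ′ : Formula (2 + n)
      φ′ = ∃̇ ∃̇ (pair (suc (suc zero)) (suc zero) zero ∧̇ φ ⟪ ρ ⟫)

      instance
        φ-stable : ∀ {e} → Stable (⟦ φ ⟧ e)
        φ-stable = ⟦⟧-stable φ

      rename : ∀ {t x x′ y q} → x ≈ x′ → q ≈ p →
               ⟦ φ ⟪ ρ ⟫ ⟧ (q Vector.∷ x Vector.∷ t Vector.∷ y Vector.∷ e′) ↔
               ⟦ φ ⟧ (x′ Vector.∷ y Vector.∷ e)
      rename f g = ⟦⟪⟫⟧ φ λ
        { zero                → f
        ; (suc zero)          → ≈-refl
        ; (suc (suc zero))    → g
        ; (suc (suc (suc i))) → ≈-refl }

      unfold : ∀ {t x y} → Pair t x p →
               ⟦ φ′ ⟧ (t Vector.∷ y Vector.∷ e′) ↔ ⟦ φ ⟧ (x Vector.∷ y Vector.∷ e)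
      unfold {t} {x} {y} r =
        (λ h → h >>= λ x′ h₁ → h₁ >>= λ q (r′ , h₂) → proj₁ (rename {t}
          (extensional (Pair-injective₁ r′ r)) (extensional (Pair-injective₂ r′ r))) h₂) ,
        (λ h → someˣ x (someˣ p (r , proj₂ (rename {t} ≈-refl ≈-refl) h)))

    ∀*-intro : ∀ n (φ : Formula n) → (∀ e → ⟦ φ ⟧ e) → Satisfies (∀* n φ)
    ∀*-intro zero    φ h = h Vector.[]
    ∀*-intro (suc n) φ h = ∀*-intro n (∀̇ φ) λ e x → h (x Vector.∷ e)

    -- Functionality makes each image class empty or a single set up to `_≋_`, hence small, as
    -- `collect*` requires.
    replacement-holds : ∀ n φ → Satisfies (replacement n φ)
    replacement-holds n φ = ∀*-intro n _ λ e a functional →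
      collect* n φ e a (λ x x∈a → subsingleton-small _ ⦃ ⟦⟧-stable φ ⦄
        (λ {y} {z} p q → ≈⇒≋ (functional x x∈a y z
          ( proj₂ (⟦⟪⟫⟧ φ λ { zero → ≈-refl ; (suc zero) → ≈-refl ; (suc (suc i)) → ≈-refl }) p
          , proj₂ (⟦⟪⟫⟧ φ λ { zero → ≈-refl ; (suc zero) → ≈-refl ; (suc (suc i)) → ≈-refl }) q)))
        (λ y≋z → ⟦⟧-resp φ λ
          { zero → ≈-refl ; (suc zero) → extensional y≋z ; (suc (suc i)) → ≈-refl }))
      >>= λ b members → someˣ b λ y →
        (λ y∈b → proj₁ (members y) y∈b >>= λ x (x∈a , p) → someˣ x (x∈a , proj₂ (unfold b) p)) ,
        (λ h → h >>= λ x (x∈a , p) → proj₂ (members y) (someˣ x (x∈a , proj₁ (unfold b) p)))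
      where
      unfold : ∀ {x y a e} b →
               ⟦ φ ⟪ zero Vector.∷ suc zero Vector.∷ (4 ↑ʳ_) ⟫ ⟧
                 (x Vector.∷ y Vector.∷ b Vector.∷ a Vector.∷ e) ↔
               ⟦ φ ⟧ (x Vector.∷ y Vector.∷ e)
      unfold b = ⟦⟪⟫⟧ φ λ { zero → ≈-refl ; (suc zero) → ≈-refl ; (suc (suc i)) → ≈-refl }

-- The inner model

private
  v0 : Fin (1 + n)
  v0 = zero
  v1 : Fin (2 + n)
  v1 = suc v0
  v2 : Fin (3 + n)
  v2 = suc v1

closed : Fin n → Formula n
closed u = ∀̇ (v0 ∈̇ suc u ⇒ (∀̇ (v0 ≋̇ v1 ⇒ v0 ∈̇ suc (suc u))))

hereditary : Fin n → Formula n
hereditary x =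
  ∀̇ (suc x ∈̇ v0 ⇒ (∃̇ (v0 ∈̇ v1 ∧̇ closed v0 ∧̇ (∀̇ (v0 ∈̇ v1 ⇒ ¬̇ v0 ∈̇ v2)))))

inner : Translation
inner = record
  { domain     = hereditary zero
  ; membership = zero ∈̇ suc zero
  ; equality   = zero ≋̇ suc zero
  }

open Translation inner using (_ᴵ)

module ParameterFree (𝔐 : Structure) (models : Models 𝔐 ZF*−Ext) where
  open Sets 𝔐 public

  -- An `x` whose class is not a set simply contributes nothing; `inner-infinity` relies on this.
  collect-extensions : ∀ (φ : Formula 2) a →
    Small λ y → ∃ˣ[ x ] (x ϵ a × (y represents λ z → ⟦ φ ⟧ (x Vector.∷ z Vector.∷ Vector.[])))
  collect-extensions φ a = models _ (replacement*-ax φ) a >>= λ b members → someˣ b λ y →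
    (λ y∈b → proj₁ (members y) y∈b >>= λ x (x∈a , r) →
      someˣ x (x∈a , represents-map (λ z → rename) r)) ,
    (λ h → h >>= λ x (x∈a , r) →
      proj₂ (members y) (someˣ x (x∈a , represents-map (λ z → swap rename) r)))
    where
    rename : ∀ {x y z b} →
             ⟦ φ ⟪ v1 Vector.∷ v0 Vector.∷ Vector.[] ⟫ ⟧
               (z Vector.∷ x Vector.∷ y Vector.∷ b Vector.∷ a Vector.∷ Vector.[]) ↔
             ⟦ φ ⟧ (x Vector.∷ z Vector.∷ Vector.[])
    rename = ⟦⟪⟫⟧ φ λ { zero → ≈-refl ; (suc zero) → ≈-refl }

  union-pairing : UnionPairing 𝔐
  union-pairing = record
    { pairs  = record
      { unordered-pair = λ a b → models _ pairing-ax a b >>= λ c members →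
          Small-map (λ y →
            (λ h → h >>= λ x (x∈c , y≋x) → ∨-map
              (λ x≈a → ≋-trans y≋x (≈⇒≋ x≈a)) (λ x≈b → ≋-trans y≋x (≈⇒≋ x≈b))
              (proj₁ (members x) x∈c)) ,
            (λ h → ∨-case h
              (λ y≋a → someˣ a (proj₂ (members a) (inlˣ ≈-refl) , y≋a))
              (λ y≋b → someˣ b (proj₂ (members b) (inrˣ ≈-refl) , y≋b))))
            -- For this formula the class of `x` is the extension of `x`, so all copies of elements
            -- of `c` are collected.
            (collect-extensions (v1 ∈̇ v0) c)
      ; empty-set = models _ infinity-ax >>= λ n (h , _) → h >>= λ e (_ , none) →
          someˣ e λ z z∈e → none (someˣ z z∈e)
      }
    ; unions = models _ union-ax
    }

  open UnionPairingProperties 𝔐 union-pairing public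

  collect : ∀ (φ : Formula 2) a →
            (∀ x → x ϵ a → Small λ y → ⟦ φ ⟧ (x Vector.∷ y Vector.∷ Vector.[])) →
            Small λ y → ∃ˣ[ x ] (x ϵ a × ⟦ φ ⟧ (x Vector.∷ y Vector.∷ Vector.[]))
  collect φ a small = collect-extensions φ a >>= λ b members →
    Small-map (λ y →
      (λ h → h >>= λ c (c∈b , y∈c) → proj₁ (members c) c∈b >>= λ x (x∈a , r) →
        someˣ x (x∈a , proj₁ (r y) y∈c)) ,
      (λ h → h >>= λ x (x∈a , p) → small x x∈a >>= λ c r →
        someˣ c (proj₂ (members c) (someˣ x (x∈a , r)) , proj₂ (r y) p)))
      (unions b)
    where
    instance
      φ-stable : ∀ {e} → Stable (⟦ φ ⟧ e)
      φ-stable = ⟦⟧-stable φ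

  -- Hereditary sets

  Closed : Carrier → Set
  Closed u = ∀ v → v ϵ u → ∀ w → w ≋ v → w ϵ u

  -- By Foundation, s has a member disjoint from s.  So a set s containing x but no
  -- such closed member leads from x down to a set that is not closed.
  Hereditary : Carrier → Set
  Hereditary x = ∀ s → x ϵ s → ∃ˣ[ u ] (u ϵ s × Closed u × (∀ v → v ϵ u → v ϵ s → Absurd))

  Closed-resp : ∀ {x y} → x ≋ y → Closed x → Closed y
  Closed-resp p c v v∈y w w≋v = proj₁ (p w) (c v (proj₂ (p v) v∈y) w w≋v)

  -- Either `x` itself is a closed member disjoint from `s`, or some element of `x` lies in `s` and
  -- its heredity supplies the member.
  hereditary-intro : ∀ {x} → Closed x → (∀ y → y ϵ x → Hereditary y) → Hereditary x
  hereditary-intro {x} c h s x∈s k = k x (x∈s , c , λ v v∈x v∈s → h v v∈x s v∈s k)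

  hereditary-closed : ∀ {x} → Hereditary x → Closed x
  hereditary-closed {x} h = singleton-exists x >>= λ s r →
    h s (proj₂ (r x) ≋-refl) >>= λ u (u∈s , c , _) → Closed-resp (proj₁ (r u) u∈s) c

  -- Add all copies of `x` to `s`. The closed member found in the larger set cannot be a copy of
  -- `x`, which would share the element `y` with it, so it lies in `s`.
  hereditary-element : ∀ {x y} → Hereditary x → y ϵ x → Hereditary y
  hereditary-element {x} {y} h y∈x s y∈s k =
    binary-union (someˣ s λ _ → id , id) (singleton-exists x) λ s′ r →
      h s′ (proj₂ (r x) (inrˣ ≋-refl)) λ u (u∈s′ , c , disjoint) → proj₁ (r u) u∈s′
        (λ u∈s → k u (u∈s , c , λ v v∈u v∈s → disjoint v v∈u (proj₂ (r v) (inlˣ v∈s))))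
        (λ u≋x → disjoint y (proj₂ (u≋x y) y∈x) (proj₂ (r y) (inlˣ y∈s)))

  hereditary-resp : ∀ {x y} → x ≋ y → Hereditary x → Hereditary y
  hereditary-resp p h = hereditary-intro (Closed-resp p (hereditary-closed h))
    λ z z∈y → hereditary-element h (proj₂ (p z) z∈y)

  hereditary-empty : ∀ {x} → Empty x → Hereditary x
  hereditary-empty empty = hereditary-intro
    (λ v v∈x → absurd (empty v v∈x)) (λ y y∈x → absurd (empty y y∈x))

  -- The structure of hereditary sets up to coextensionality

  𝔑 : Structure
  𝔑 = record
    { Carrier    = Σ Carrier Hereditary
    ; Absurd     = Absurd
    ; _ϵ_        = λ (x , _) (y , _) → x ϵ y
    ; _≈_        = λ (x , _) (y , _) → x ≋ y
    ; ∈-stable   = dne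
    ; ≈-stable   = dne
    ; ≈-refl     = ≋-refl
    ; ≈-sym      = ≋-sym
    ; ≈-trans    = ≋-trans
    -- Closedness of the containing set is what makes coextensionality a congruence for membership.
    ; ∈-resp     = λ {_} {_} {_} {(_ , h)} p q x∈y →
        hereditary-closed h _ (proj₁ (q _) x∈y) _ (≋-sym p)
    ; inhabited  = λ k → empty-set λ x empty → k (x , hereditary-empty empty)
    }

  module N = Sets 𝔑

  transfer : (φ : Formula n) {e : N.Env n} {e′ : Env n} → (∀ i → proj₁ (e i) ≡ e′ i) →
             N.⟦ φ ⟧ e ↔ ⟦ φ ᴵ ⟧ e′
  transfer (i ∈̇ j) eq =
    subst₂ _ϵ_ (eq i) (eq j) , subst₂ _ϵ_ (sym (eq i)) (sym (eq j))
  transfer (i ≐ j) eq =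
    subst₂ _≋_ (eq i) (eq j) , subst₂ _≋_ (sym (eq i)) (sym (eq j))
  transfer ⊥̇       eq = id , id
  transfer (φ ⇒ ψ) eq =
    let f , f′ = transfer φ eq ; g , g′ = transfer ψ eq
    in (λ h → g ∘ h ∘ f′) , (λ h → g′ ∘ h ∘ f)
  transfer (φ ∧̇ ψ) eq =
    let f , f′ = transfer φ eq ; g , g′ = transfer ψ eq
    in Product.map f g , Product.map f′ g′
  transfer (φ ∨̇ ψ) eq = ∨-cong (transfer φ eq) (transfer ψ eq)
  transfer (∀̇ φ)   eq =
    (λ h x d → proj₁ (transfer φ λ { zero → refl ; (suc i) → eq i }) (h (x , d))) ,
    (λ h (x , d) → proj₂ (transfer φ λ { zero → refl ; (suc i) → eq i }) (h x d))
  transfer (∃̇ φ)   eq =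
    (λ h k → h λ (x , d) p →
      k x (d , proj₁ (transfer φ λ { zero → refl ; (suc i) → eq i }) p)) ,
    (λ h k → h λ x (d , p) →
      k (x , d) (proj₂ (transfer φ λ { zero → refl ; (suc i) → eq i }) p))

  ≋⇒≋ᴺ : ∀ {x y} → proj₁ x ≋ proj₁ y → x N.≋ y
  ≋⇒≋ᴺ p z = p (proj₁ z)

  -- Elements of hereditary sets are hereditary, so the inner quantifier misses none of them.
  ≋ᴺ⇒≋ : ∀ {x y} → x N.≋ y → proj₁ x ≋ proj₁ y
  ≋ᴺ⇒≋ {_ , h} {_ , h′} p z =
    (λ z∈x → proj₁ (p (z , hereditary-element h z∈x)) z∈x) ,
    (λ z∈y → proj₂ (p (z , hereditary-element h′ z∈y)) z∈y)

  represented-hereditary : ∀ {c} {P : Carrier → Set} → c represents P → (∀ y → P y → Hereditary y) →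
                           (∀ {y z} → y ≋ z → P y → P z) → Hereditary c
  represented-hereditary r her resp = hereditary-intro
    (λ v v∈c w w≋v → proj₂ (r w) (resp (≋-sym w≋v) (proj₁ (r v) v∈c)))
    (λ y y∈c → her y (proj₁ (r y) y∈c))

  inner-small : {P : Carrier → Set} → (∀ y → P y → Hereditary y) →
                (∀ {y z} → y ≋ z → P y → P z) → Small P → N.Small (P ∘ proj₁)
  inner-small her resp small k =
    small λ c r → k (c , represented-hereditary r her resp) (r ∘ proj₁)

  inner-extensional : Extensional 𝔑
  inner-extensional = record
    { extensional   = λ {x} {y} → ≋ᴺ⇒≋ {x} {y}
    ; union-pairing = record
      { pairs  = record
        { unordered-pair = λ a@(_ , ha) b@(_ , hb) →
            N.Small-map (λ y → ∨-cong (≋⇒≋ᴺ {y} {a} , ≋ᴺ⇒≋ {y} {a}) (≋⇒≋ᴺ {y} {b} , ≋ᴺ⇒≋ {y} {b}))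
              (inner-small
                (λ y h → ∨-case h (λ p → hereditary-resp (≋-sym p) ha) (λ p → hereditary-resp (≋-sym p) hb))
                (λ p → ∨-map (≋-trans (≋-sym p)) (≋-trans (≋-sym p)))
                (unordered-pair (proj₁ a) (proj₁ b)))
        ; empty-set = λ k → empty-set λ x empty → k (x , hereditary-empty empty) (empty ∘ proj₁)
        }
      ; unions = λ (a , ha) →
          N.Small-map (λ (y , _) →
            (λ h k → h λ z (z∈a , y∈z) → k (z , hereditary-element ha z∈a) (z∈a , y∈z)) ,
            (λ h k → h λ (z , _) → k z))
            (inner-small
              (λ y h → h >>= λ z (z∈a , y∈z) → hereditary-element (hereditary-element ha z∈a) y∈z)
              (λ p h → h >>= λ z (z∈a , y∈z) → someˣ z
                (z∈a , hereditary-closed (hereditary-element ha z∈a) _ y∈z _ (≋-sym p)))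
              (unions a))
      }
    ; powers        = λ (a , ha) →
        N.Small-map (λ (y , hy) →
          (λ (_ , h) z → h (proj₁ z)) ,
          (λ h → hy , λ z z∈y → h (z , hereditary-element hy z∈y) z∈y))
          (inner-small (λ y → proj₁)
            (λ p (h , s) → hereditary-resp p h , λ z z∈y → s z (proj₂ (p z) z∈y))
            (hereditary-subsets a))
    ; collect       = λ φ e (a , ha) small →
        N.Small-map (λ (y , hy) →
          (λ h k → h λ x (x∈a , _ , p) → let hx = hereditary-element ha x∈a in
            k (x , hx) (x∈a , proj₂ (transfer φ {(x , hx) Vector.∷ (y , hy) Vector.∷ e} λ
              { zero → refl ; (suc zero) → refl }) p)) ,
          (λ h k → h λ (x , hx) (x∈a , p) → k x (x∈a , hy , proj₁ (transfer φ λ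
            { zero → refl ; (suc zero) → refl }) p)))
          (inner-small
            (λ y h → h >>= λ x (_ , hy , _) → hy)
            (λ {y} {z} y≋z h → h >>= λ x (x∈a , hy , p) →
              let hx = hereditary-element ha x∈a
                  hz = hereditary-resp y≋z hy
              in someˣ x (x∈a , hz , proj₁ (transfer φ λ { zero → refl ; (suc zero) → refl })
                (N.⟦⟧-resp φ {(x , hx) Vector.∷ (y , hy) Vector.∷ e} {(x , hx) Vector.∷ (z , hz) Vector.∷ e}
                  (λ { zero → ≋-refl ; (suc zero) → y≋z ; (suc (suc ())) })
                  (proj₂ (transfer φ λ { zero → refl ; (suc zero) → refl }) p))))
            -- The guard `hereditary v1` cuts the class down to the inner model, so that the set
            -- given by inner smallness represents it in the ambient model too.
            (collect (hereditary v1 ∧̇ φ ᴵ) a λ x x∈a k →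
              small (x , hereditary-element ha x∈a) x∈a λ (c , hc) r → k c λ y →
                (λ y∈c → let hy = hereditary-element hc y∈c in
                  hy , proj₁ (transfer φ λ { zero → refl ; (suc zero) → refl }) (proj₁ (r (y , hy)) y∈c)) ,
                (λ (hy , p) → proj₂ (r (y , hy))
                  (proj₂ (transfer φ λ { zero → refl ; (suc zero) → refl }) p))))
    }
    where
    hereditary-subsets : ∀ a → Small λ y → Hereditary y × (∀ z → z ϵ y → z ϵ a)
    hereditary-subsets a = models _ power-ax a >>= λ b members →
      Small-map (λ y →
        (λ h → h >>= λ x (x∈b , hx , y≋x) →
          hereditary-resp (≋-sym y≋x) hx , λ z z∈y → proj₁ (members x) x∈b z (proj₁ (y≋x z) z∈y)) ,
        (λ (hy , s) → someˣ y (proj₂ (members y) s , hy , ≋-refl)))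
        -- Separation through `collect`: a hereditary `x` contributes its copies, any other `x`
        -- nothing.
        (collect (hereditary v0 ∧̇ v1 ≋̇ v0) b λ x _ → subsingleton-small _
          (λ (_ , y≋x) (_ , z≋x) → ≋-trans y≋x (≋-sym z≋x))
          (λ y≋z (hx , y≋x) → hx , ≋-trans (≋-sym y≋z) y≋x))

-- Infinity in the inner model

successor : Fin n → Fin n → Formula n
successor m x = ∀̇ (v0 ∈̇ suc m ⇔ v0 ∈̇ suc x ∨̇ v0 ≐ suc x)

≋-successor : Fin n → Fin n → Formula n
≋-successor m x = ∀̇ (v0 ∈̇ suc m ⇔ v0 ∈̇ suc x ∨̇ v0 ≋̇ suc x)

-- The asymmetry is deliberate: `x` grows by the successor that the ambient axiom of Infinity
-- supplies, adjoining only sets equal to the predecessor, while `d` adjoins all its copies and so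
-- stays closed.
step : Fin n → Fin n → Fin n → Formula n
step g x d = hereditary d ∧̇ (empty x ∧̇ empty d ∨̇
  (∃̇ ∃̇ ∃̇ (v2 ∈̇ (3 ↑ʳ g) ∧̇ pair v2 v1 v0 ∧̇ successor (3 ↑ʳ x) v1 ∧̇ ≋-successor (3 ↑ʳ d) v0)))

-- A partial run of a recursion, as in the recursion theorem: each pair in `g` is justified by the
-- base case or by another pair in `g`.
attempt : Fin n → Formula n
attempt g = ∀̇ (v0 ∈̇ suc g ⇒ (∃̇ ∃̇ (pair v2 v1 v0 ∧̇ step (3 ↑ʳ g) v1 v0)))

counts : Fin n → Fin n → Formula n
counts x d = ∃̇ (attempt v0 ∧̇ (∃̇ (v0 ∈̇ v1 ∧̇ pair v0 (2 ↑ʳ x) (2 ↑ʳ d))))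

module Infinity (𝔐 : Structure) (models : Models 𝔐 ZF*−Ext) where
  open ParameterFree 𝔐 models

  Successor : Carrier → Carrier → Set
  Successor m x = m represents λ y → y ϵ x ∨ˣ y ≈ x

  ≋-Successor : Carrier → Carrier → Set
  ≋-Successor m x = m represents λ y → y ϵ x ∨ˣ y ≋ x

  Predecessors : (Carrier → Carrier → Set) → Carrier → Carrier → Set
  Predecessors R x d = ∃ˣ[ x′ ] ∃ˣ[ d′ ] (R x′ d′ × Successor x x′ × ≋-Successor d d′)

  Step : Carrier → Carrier → Carrier → Set
  Step g x d = Hereditary d × (Empty x × Empty d ∨ˣ (∃ˣ[ t ] ∃ˣ[ x′ ] ∃ˣ[ d′ ]
    (t ϵ g × Pair t x′ d′ × Successor x x′ × ≋-Successor d d′)))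

  Attempt : Carrier → Set
  Attempt g = ∀ t → t ϵ g → ∃ˣ[ x ] ∃ˣ[ d ] (Pair t x d × Step g x d)

  -- Because a witnessing attempt g is a set, counts-inv, counts-empty and
  -- counts-successor all hold without any induction.
  Counts : Carrier → Carrier → Set
  Counts x d = ∃ˣ[ g ] (Attempt g × (∃ˣ[ t ] (t ϵ g × Pair t x d)))

  Counts-resp : ∀ {x y c d} → x ≋ y → c ≋ d → Counts x c → Counts y d
  Counts-resp p q h k = h λ g (att , h′) → h′ λ t (t∈g , r) →
    k g (att , someˣ t (t∈g , Pair-resp ≋-refl p q r))

  counts-inv : ∀ {x d} → Counts x d → Hereditary d × (Empty x × Empty d ∨ˣ Predecessors Counts x d)
  counts-inv h = h >>= λ g (att , h′) → h′ >>= λ t (t∈g , r) →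
    att t t∈g >>= λ x₀ h″ → h″ >>= λ d₀ (r₀ , her , s) →
      let x₀≋x = Pair-injective₁ r₀ r ; d₀≋d = Pair-injective₂ r₀ r in
      hereditary-resp d₀≋d her ,
      ∨-map (λ (ex , ed) → Empty-resp x₀≋x ex , Empty-resp d₀≋d ed)
        (λ pre k → pre λ t′ pre → pre λ x′ pre → pre λ d′ (t′∈g , r′ , sx , sd) →
          k x′ λ k → k d′
            ( someˣ g (att , someˣ t′ (t′∈g , r′))
            , represents-resp x₀≋x sx , represents-resp d₀≋d sd))
        s

  counts-empty : ∀ {x d} → Empty x → Empty d → Counts x d
  counts-empty {x} {d} ex ed = pair-exists x d >>= λ t r → singleton-exists t >>= λ g s →
    someˣ g
      ( (λ t′ t′∈g → someˣ x (someˣ d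
          ( Pair-resp (≋-sym (proj₁ (s t′) t′∈g)) ≋-refl ≋-refl r
          , hereditary-empty ed , inlˣ (ex , ed))))
      , someˣ t (proj₂ (s t) ≋-refl , r))

  ≋-successor-exists : ∀ d → ∃ˣ[ m ] ≋-Successor m d
  ≋-successor-exists d = binary-union (someˣ d λ _ → id , id) (singleton-exists d)

  ≋-successor-hereditary : ∀ {m d} → ≋-Successor m d → Hereditary d → Hereditary m
  ≋-successor-hereditary s her = represented-hereditary s
    (λ y h → ∨-case h (hereditary-element her) (λ p → hereditary-resp (≋-sym p) her))
    (λ p → ∨-map (λ y∈d → hereditary-closed her _ y∈d _ (≋-sym p)) (≋-trans (≋-sym p)))

  -- Add the copies of the new pair to the attempt for the old one. Old pairs keep their
  -- justification because it only asks for members of the attempt.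
  counts-successor : ∀ {x x′ d d′} → Counts x′ d′ → Successor x x′ → ≋-Successor d d′ → Counts x d
  counts-successor {x} {x′} {d} {d′} c sx sd = c >>= λ g (att , h) → h >>= λ t (t∈g , r) →
    pair-exists x d >>= λ u q → binary-union (someˣ g λ _ → id , id) (singleton-exists u) >>= λ g′ s →
    let
      extend : ∀ {x d} → Step g x d → Step g′ x d
      extend = Product.map₂ (∨-map id λ h k → h λ t h → h λ x′ h → h λ d′ (t∈g , rest) →
        k t λ k → k x′ λ k → k d′ (proj₂ (s t) (inlˣ t∈g) , rest))
      new : Step g′ x d
      new = ≋-successor-hereditary sd (proj₁ (counts-inv c)) ,
        inrˣ (someˣ t (someˣ x′ (someˣ d′ (proj₂ (s t) (inlˣ t∈g) , r , sx , sd))))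
    in someˣ g′
      ( (λ v v∈g′ → ∨-case (proj₁ (s v) v∈g′)
          (λ v∈g → att v v∈g >>= λ y h → h >>= λ c (p , st) → someˣ y (someˣ c (p , extend st)))
          (λ v≋u → someˣ x (someˣ d (Pair-resp (≋-sym v≋u) ≋-refl ≋-refl q , new))))
      , someˣ u (proj₂ (s u) (inrˣ ≋-refl) , q))

  -- Apply Foundation to the set of copies of `x` and `y`: every copy of one contains the other, so
  -- no member is minimal.
  ∈-asymmetric : ∀ {x y} → x ϵ y → y ϵ x → Absurd
  ∈-asymmetric {x} {y} x∈y y∈x = unordered-pair x y >>= λ a r →
    let x∈a = proj₂ (r x) (inlˣ ≋-refl)
        y∈a = proj₂ (r y) (inrˣ ≋-refl)
    in models _ foundation-ax a (someˣ x x∈a) λ z (z∈a , none) → proj₁ (r z) z∈a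
      (λ z≋x → none (someˣ y (y∈a , proj₂ (z≋x y) y∈x)))
      (λ z≋y → none (someˣ x (x∈a , proj₂ (z≋y x) x∈y)))

  -- Both `x` and `y` lie in `m`, so unless they are equal each is an element of the other.
  Successor-injective : ∀ {m x y} → Successor m x → Successor m y → x ≋ y
  Successor-injective {m} {x} {y} r s =
    ∨-case (proj₁ (s x) (proj₂ (r x) (inrˣ ≈-refl)))
      (λ x∈y → ∨-case (proj₁ (r y) (proj₂ (s y) (inrˣ ≈-refl)))
        (λ y∈x → absurd (∈-asymmetric x∈y y∈x)) (λ y≈x → ≋-sym (≈⇒≋ y≈x)))
      ≈⇒≋

  counts-empty-small : ∀ {x} → Empty x → Small (Counts x)
  counts-empty-small {x} ex = Small-map (λ d →
    (λ r → counts-empty ex λ y → proj₁ (r y)) ,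
    (λ c → ∨-case (proj₂ (counts-inv c)) (λ (_ , ed) → Empty-represents ed)
      (λ pre → pre >>= λ x′ pre → pre >>= λ d′ (_ , sx , _) →
        absurd (ex x′ (proj₂ (sx x′) (inrˣ ≈-refl))))))
    (class-small (Empty-represents ex))

  -- By injectivity of successors, what `m` counts are exactly the successors of what `x` counts,
  -- and `collect` gathers these.
  counts-successor-small : ∀ {x m} → Successor m x → Small (Counts x) → Small (Counts m)
  counts-successor-small {x} sm small = small >>= λ c r → Small-map (λ d →
    (λ h → h >>= λ d′ (d′∈c , sd) → counts-successor (proj₁ (r d′) d′∈c) sm sd) ,
    (λ cd → ∨-case (proj₂ (counts-inv cd))
      (λ (em , _) → absurd (em x (proj₂ (sm x) (inrˣ ≈-refl))))
      (λ pre → pre >>= λ x′ pre → pre >>= λ d′ (cd′ , sm′ , sd) → someˣ d′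
        (proj₂ (r d′) (Counts-resp (Successor-injective sm′ sm) ≋-refl cd′) , sd))))
    (collect (≋-successor v1 v0) c λ d _ → ≋-successor-exists d >>= λ s → class-small)

  inner-infinity : N.Satisfies infinity
  inner-infinity = models _ infinity-ax >>= λ ω (zero∈ω , suc∈ω) →
    -- The set `ω` may have members that are not numerals, for which smallness of `Counts x` is
    -- unknown. Only those `x` with a small class contribute. They include the empty members and are
    -- closed under successor, so no induction along `ω` is needed.
    collect-extensions (counts v0 v1) ω >>= λ b members → unions b >>= λ w r →
    let
      into : ∀ {x d} → x ϵ ω → Small (Counts x) → Counts x d → d ϵ w
      into {x} {d} x∈ω small cd = small >>= λ c s →
        proj₂ (r d) (someˣ c (proj₂ (members c) (someˣ x (x∈ω , s)) , proj₂ (s d) cd))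
      out : ∀ {d} → d ϵ w → ∃ˣ[ x ] (x ϵ ω × Small (Counts x) × Counts x d)
      out {d} d∈w = proj₁ (r d) d∈w >>= λ c (c∈b , d∈c) → proj₁ (members c) c∈b >>= λ x (x∈ω , s) →
        someˣ x (x∈ω , someˣ c s , proj₁ (s d) d∈c)
      her : Hereditary w
      her = hereditary-intro
        (λ v v∈w u u≋v → out v∈w >>= λ x (x∈ω , small , c) →
          into x∈ω small (Counts-resp ≋-refl (≋-sym u≋v) c))
        (λ d d∈w → out d∈w >>= λ x (_ , _ , c) → proj₁ (counts-inv c))
    in N.someˣ (w , her)
      ( (λ k → zero∈ω λ e (e∈ω , none) →
          let ee = λ z z∈e → none (someˣ z z∈e) in
          k (e , hereditary-empty ee)
            (into e∈ω (counts-empty-small ee) (counts-empty ee ee) , λ h → h (ee ∘ proj₁)))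
      , λ (d , hd) d∈w k → out d∈w λ x (x∈ω , small , c) → suc∈ω x x∈ω λ m (m∈ω , sm) →
          ≋-successor-exists d λ d⁺ sd → k (d⁺ , ≋-successor-hereditary sd hd)
            (into m∈ω (counts-successor-small sm small) (counts-successor c sm sd) , sd ∘ proj₁))

  inner-models : Models 𝔑 ZF
  inner-models _ extensionality-ax = λ x y → ≋ᴺ⇒≋ {x} {y}
  inner-models _ foundation-ax (a , ha) some k =
    models _ foundation-ax a (λ l → some λ (x , _) → l x) λ y (y∈a , none) →
      k (y , hereditary-element ha y∈a) (y∈a , λ h → none λ l → h λ (z , _) → l z)
  inner-models _ pairing-ax a b = N.Small-map
    (λ y → N.∨-cong (≋ᴺ⇒≋ {y} {a} , ≋⇒≋ᴺ {y} {a}) (≋ᴺ⇒≋ {y} {b} , ≋⇒≋ᴺ {y} {b}))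
    (E.unordered-pair a b)
    where module E = ExtensionalProperties 𝔑 inner-extensional
  inner-models _ union-ax    = UnionPairing.unions (Extensional.union-pairing inner-extensional)
  inner-models _ power-ax    = Extensional.powers inner-extensional
  inner-models _ infinity-ax = inner-infinity
  inner-models _ (replacement-ax n φ) =
    ExtensionalProperties.replacement-holds 𝔑 inner-extensional n φ

mainTheorem1 : ZF*−Ext interprets ZF
mainTheorem1 = inner , λ φ d → completeness ZF*−Ext (φ ᴵ) λ 𝔐 models →
  let open ParameterFree 𝔐 models ; open Infinity 𝔐 models in
  -- Soundness turns the derivation in `ZF` into truth in the inner model, and `transfer` moves this
  -- to the translated sentence in the ambient model, as `completeness` requires.
  proj₁ (transfer φ λ ()) (N.sound inner-models d Vector.[] [])
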